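{- For $k\ge i\ge1$ and integers $N_1\ge N_2\ge\cdots\ge N_{k-1}\ge0$, there is a bijection $\Phi:\mathbb{F}_{N_1,\dots,N_{k-1};i}\to\mathbb{R}_{N_1-1}\times\mathbb{G}_{N_1,\dots,N_{k-1};i}$ such that whenever $\Phi(\lambda)=(\tau,\mu)$ we have $|\lambda|=|\tau|+|\mu|$.
   Context: An overpartition of $n$ is a partition of $n$ in which the first occurrence of each part size may be overlined. Parts are ordered by $\overline1<1<\overline2<2<\cdots$, and an overpartition is written $\lambda=(\lambda_1,\dots,\lambda_\ell)$ with $\lambda_1\le\cdots\le\lambda_\ell$ in this order; $|\lambda_j|$ is the numerical size of a part, $|\lambda|=\sum_j|\lambda_j|$. For $t\ge1$, $f_t(\lambda)$ (resp. $f_{\overline t}(\lambda)$) is the number of non-overlined (resp. overlined) parts equal to $t$; $f_0=f_{\overline0}=0$. Göllnitz–Gordon marking: marks are assigned to $\lambda_1,\dots,\lambda_\ell$ in this order; $\lambda_1$ gets mark $1$. For $p>1$: (a) a non-overlined odd $\lambda_p$ gets mark $1$; (b) an overlined even $\lambda_p$ gets mark $1$; (c) an overlined odd $\lambda_p$ gets the least positive integer not used as the mark of any $\lambda_j$ ($j<p$) with $|\lambda_p|-|\lambda_j|=1$; (d) if $\lambda_p=2t+2$ is non-overlined even, let $f$ be the least positive integer not used as the mark of any $\lambda_j$ ($j<p$) with $|\lambda_p|-|\lambda_j|\le2$, and $g$ the least positive integer used as the mark of some $\lambda_j$ ($j<p$) with $|\lambda_p|-|\lambda_j|=2$ ($g=0$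 if none); if simultaneously (i) $g\ge2$, (ii) the mark of $\lambda_{p-1}$ is $g-1$, (iii) a non-overlined $2t+1$ or an $\overline{2t+2}$ occurs in $\lambda$, (iv) $\overline{2t+1}$ does not occur in $\lambda$, then $\lambda_p$ gets mark $g$, otherwise mark $f$. A part with mark $r$ is $r$-marked. $\mathbb{O}_{k,i}(m,n)$: overpartitions of $n$ with exactly $m$ parts such that (1) $f_{\overline1}+f_2\le i-1$; (2) $f_{\overline{2t}}+f_{2t}+f_{\overline{2t+1}}+f_{2t+2}\le k-1$ for all $t\ge0$; (3) for all $t\ge0$, $f_{2t+1}\ge1$ implies $f_{2t+2}\le k-2$. $\mathbb{F}_{k,i}(m,n)$: those $\lambda\in\mathbb{O}_{k,i}(m,n)$ whose smallest part is an overlined odd part or a non-overlined even part. $\mathbb{F}_{N_1,\dots,N_{k-1};i}$: the set of $\lambda\in\bigcup_{n\ge0}\mathbb{F}_{k,i}(N_1+\cdots+N_{k-1},n)$ having exactly $N_r$ $r$-marked parts for each $1\le r\le k-1$. $\mathbb{G}_{N_1,\dots,N_{k-1};i}$: those $\lambda\in\mathbb{F}_{N_1,\dots,N_{k-1};i}$ with no overlined even parts and no non-overlined odd parts. For $N\ge0$, $\mathbb{R}_N$ is the set of finite sets (partitions) $\tau=(\tau_1<\cdots<\tau_\ell)$ of distinct negative even integers in $[-2N,-2]$, with $|\tau|=\tau_1+\cdots+\tau_\ell$ (so $\sum_{\tau\in\mathbb{R}_N}q^{|\tau|}=(-q^{ -2N};q^2)_N$). -}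

module Defs where

open import Data.Nat using (ℕ; zero; suc; _+_; _*_; _∸_; _≤_; _⊓_; _≡ᵇ_; _≤ᵇ_)
open import Data.Bool using (Bool; true; false; if_then_else_; _∧_; _∨_; not)
open import Data.Product using (_×_; _,_; proj₁; proj₂; Σ; ∃)
open import Data.Sum using (_⊎_)
open import Data.Empty using (⊥)
open import Data.List using (List; []; _∷_; length; map)
open import Data.Nat.ListAction using (sum)
open import Data.List.Relation.Unary.All using (All)
open import Data.List.Relation.Unary.Linked using (Linked)
open import Data.Vec using (Vec; lookup) renaming ([] to []ᵥ; _∷_ to _∷ᵥ_)
open import Data.Fin using (Fin; toℕ)
open import Data.Integer as ℤ using (ℤ; +_; -_)
open import Relation.Binary.PropositionalEquality using (_≡_)
open import Relation.Nullary using (¬_)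

-- Parts of overpartitions.  A part is (size , overlined?).
Part : Set
Part = ℕ × Bool

size : Part → ℕ
size = proj₁

-- position in the order  1̄ < 1 < 2̄ < 2 < ...
key : Part → ℕ
key (s , true)  = 2 * s ∸ 1
key (s , false) = 2 * s

isEven : ℕ → Bool
isEven zero          = true
isEven (suc zero)    = false
isEven (suc (suc n)) = isEven n

eqPart : Part → Part → Bool
eqPart (s , b) (s' , b') = (s ≡ᵇ s') ∧ (if b then b' else not b')

count : Part → List Part → ℕ
count p []       = 0
count p (q ∷ qs) = (if eqPart p q then 1 else 0) + count p qs

occurs : Part → List Part → Bool
occurs p []       = false
occurs p (q ∷ qs) = eqPart p q ∨ occurs p qs

f : ℕ → List Part → ℕ
f t = count (t , false)

f̄ : ℕ → List Part → ℕ
f̄ t = count (t , true)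

total : List Part → ℕ
total lam = sum (map size lam)

-- An overpartition, written in nondecreasing order (λ₁ ≤ ... ≤ λ_ℓ)
-- w.r.t. 1̄ < 1 < 2̄ < 2 < ...; positive sizes; each size overlined at most once
-- (necessarily its first occurrence, by the ordering).
IsOverpartition : List Part → Set
IsOverpartition lam =
  All (λ p → 1 ≤ size p) lam
  × Linked (λ p q → key p ≤ key q) lam
  × (∀ s → f̄ s lam ≤ 1)

elemℕ : ℕ → List ℕ → Bool
elemℕ n []       = false
elemℕ n (x ∷ xs) = (n ≡ᵇ x) ∨ elemℕ n xs

mexGo : ℕ → ℕ → List ℕ → ℕ
mexGo zero    n xs = n
mexGo (suc k) n xs = if elemℕ n xs then mexGo k (suc n) xs else n

mex : List ℕ → ℕ
mex xs = mexGo (length xs) 1 xs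

-- least positive integer in the list (0 if none)
minPos : List ℕ → ℕ
minPos []       = 0
minPos (x ∷ xs) with x ≡ᵇ 0 | minPos xs
... | true  | m    = m
... | false | zero = x
... | false | m    = x ⊓ m

marksWhere : (ℕ → Bool) → List (Part × ℕ) → List ℕ
marksWhere P []              = []
marksWhere P ((q , m) ∷ qms) = if P (size q) then m ∷ marksWhere P qms else marksWhere P qms

-- mark of part p (p > 1) given the whole overpartition λ, the
-- earlier parts with their marks (most recent first) and the mark of λ_{p-1}
markOf : List Part → List (Part × ℕ) → ℕ → Part → ℕ
markOf lam prior prev (s , true) =
  if isEven s then 1
  else mex (marksWhere (λ u → (u + 1) ≡ᵇ s) prior)
markOf lam prior prev (s , false) =
  if not (isEven s) then 1
  else
    (if (2 ≤ᵇ g) ∧ ((prev + 1) ≡ᵇ g)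
          ∧ (occurs (s ∸ 1 , false) lam ∨ occurs (s , true) lam)
          ∧ not (occurs (s ∸ 1 , true) lam)
     then g else fv)
  where
    fv = mex (marksWhere (λ u → (u ≤ᵇ s) ∧ (s ≤ᵇ u + 2)) prior)
    g  = minPos (marksWhere (λ u → (u + 2) ≡ᵇ s) prior)

marksGo : List Part → List (Part × ℕ) → ℕ → List Part → List ℕ
marksGo lam prior prev []       = []
marksGo lam prior prev (p ∷ ps) =
  let m = markOf lam prior prev p in m ∷ marksGo lam ((p , m) ∷ prior) m ps

marks : List Part → List ℕ
marks []       = []
marks (p ∷ ps) = 1 ∷ marksGo (p ∷ ps) ((p , 1) ∷ []) 1 ps

countℕ : ℕ → List ℕ → ℕ
countℕ r []       = 0
countℕ r (x ∷ xs) = (if r ≡ᵇ x then 1 else 0) + countℕ r xs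

markedCount : ℕ → List Part → ℕ
markedCount r lam = countℕ r (marks lam)

InO : ℕ → ℕ → ℕ → ℕ → List Part → Set
InO k i m n lam =
  IsOverpartition lam × length lam ≡ m × total lam ≡ n
  × (f̄ 1 lam + f 2 lam + 1 ≤ i)
  × (∀ t → f̄ (2 * t) lam + f (2 * t) lam + f̄ (2 * t + 1) lam + f (2 * t + 2) lam + 1 ≤ k)
  × (∀ t → 1 ≤ f (2 * t + 1) lam → f (2 * t + 2) lam + 2 ≤ k)

SmallestOK : List Part → Set
SmallestOK []            = ⊥
SmallestOK ((s , b) ∷ _) = (b ≡ true × isEven s ≡ false) ⊎ (b ≡ false × isEven s ≡ true)

InFki : ℕ → ℕ → ℕ → ℕ → List Part → Set
InFki k i m n lam = InO k i m n lam × SmallestOK lam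

sumV : ∀ {n} → Vec ℕ n → ℕ
sumV []ᵥ       = 0
sumV (x ∷ᵥ xs) = x + sumV xs

-- first entry N₁ (0 if the vector is empty, i.e. k = 1)
firstV : ∀ {n} → Vec ℕ n → ℕ
firstV []ᵥ      = 0
firstV (x ∷ᵥ _) = x

-- 𝔽_{N₁,…,N_{k-1};i}; N is (N₁,…,N_{k-1}), entry r (0-based) is N_{r+1}
InF : (k i : ℕ) → Vec ℕ (k ∸ 1) → List Part → Set
InF k i N lam =
  ∃ (λ n → InFki k i (sumV N) n lam)
  × (∀ (r : Fin (k ∸ 1)) → markedCount (suc (toℕ r)) lam ≡ lookup N r)

InG : (k i : ℕ) → Vec ℕ (k ∸ 1) → List Part → Set
InG k i N lam =
  InF k i N lam
  × All (λ p → ¬ (proj₂ p ≡ true × isEven (size p) ≡ true)) lam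
  × All (λ p → ¬ (proj₂ p ≡ false × isEven (size p) ≡ false)) lam

InR : ℕ → List ℤ → Set
InR N τ =
  Linked ℤ._<_ τ
  × All (λ x → Σ ℕ (λ j → 1 ≤ j × j ≤ N × x ≡ - (+ (2 * j)))) τ

sumℤ : List ℤ → ℤ
sumℤ []       = + 0
sumℤ (x ∷ xs) = x ℤ.+ sumℤ xs

{-# OPTIONS --safe #-}

-- Sort the parts of an overpartition into columns: column t holds f̄(2t+1), f(2t+1), f̄(2t+2)
-- and f(2t+2).  The number of marks at most r is the number of parts selected by a greedy
-- algorithm of capacity r running over the columns; hence the numbers of r-marked parts, and
-- the conditions (2) and (3), depend only on these greedy counts and on the number of parts.
--
-- To eliminate the largest part that is non-overlined odd or overlined even, toggle its
-- overline and add 2 to it and to every later 1-marked part.  If there are j such parts, the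
-- size grows by 2j, and all greedy counts are unchanged (by induction on the columns, as
-- identities between greedy counts with all possible amounts of room).  The values j grow
-- strictly from one elimination to the next and stay below N₁, because the smallest part is
-- never moved.  A move is undone by marking from the right: the moved parts are the 1-marked
-- ones with respect to the reversed order, which makes every set of values j ≤ N₁ - 1 occur
-- exactly once.

module Submission where

open import Defs
open import Data.Nat
open import Data.Nat.Properties
open import Data.Nat.ListAction using (sum)
open import Data.Nat.Tactic.RingSolver using (solve-∀)
open import Data.Bool using (Bool; true; false; if_then_else_; _∧_; _∨_; not)
open import Data.Bool.Properties using (∨-zeroʳ; ∧-zeroʳ; ∧-identityʳ; T-≡)
open import Data.Empty using (⊥; ⊥-elim)
open import Data.Unit using (⊤; tt)
open import Data.Fin as Fin using (Fin; toℕ) renaming (_≤_ to _≤ᶠ_)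
open import Data.Vec using (Vec; lookup) renaming ([] to []ᵥ; _∷_ to _∷ᵥ_)
open import Data.List using (List; []; _∷_; length; map; replicate; _++_)
open import Data.List.Properties using (∷-injective; map-injective)
open import Data.List.Relation.Unary.All as All using (All; []; _∷_)
import Data.List.Relation.Unary.All.Properties as All
open import Data.List.Relation.Unary.AllPairs as AllPairs using (AllPairs; []; _∷_)
open import Data.List.Relation.Unary.Linked as Linked using (Linked; []; [-]; _∷_)
import Data.List.Relation.Unary.Linked.Properties as Linked
open import Data.Product using (Σ; ∃; _×_; _,_; proj₁; proj₂)
open import Data.Sum using (_⊎_; inj₁; inj₂)
open import Function using (Equivalence)
open import Relation.Nullary using (¬_; yes; no)
open import Relation.Binary.Definitions using (tri<; tri≈; tri>)
open import Relation.Binary.PropositionalEquality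

-- Eliminating the largest bad part first makes `phi` a fold from the right: each number of moved
-- parts is one more than a capacity-one count of the columns already processed. The capacity-one
-- count with room 1 exceeds the count with room 0 by at most one. Right after an elimination the
-- two differ by exactly one and the new number is the larger of them. So, when undoing, comparing
-- the last number with the count without room tells whether it belongs to the present column.
--
-- The counts of capacity `r` must survive a move although parts that stay behind can take over a
-- freed place; hence the identities for every room, with boundary cases for full columns. The
-- exception in rule (d) makes them fit: through it a bad part takes mark 1 without costing the even
-- parts any room, unless all `r` marks were free.
--
-- Conditions (2) and (3) are not followed along the moves. All marks are at most `k - 1`, so the
-- greedy selection of capacity `k - 1` refuses no part before a move and hence none after it, and
-- this implies both conditions.

-- Greedy counts and the move of the 1-marked parts

-- Column t is col o n b c with o = f̄(2t+1), n = f(2t+1), b = f̄(2t+2) and c = f(2t+2);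
-- it is good, and written (o , c), if n = b = 0.
Good : Set
Good = Bool × ℕ

data Col : Set where
  col : (o : Bool) (n : ℕ) (b : Bool) (c : ℕ) → Col

val : Bool → ℕ
val false = 0
val true  = 1

data Carry : Set where
  none odd even : Carry

-- Adds 2 to every 1-marked part.  The carry is the 1-marked part of the previous column; an
-- even one keeps all parts of the current column from being 1-marked.
advance : Carry → List Good → List Good
advance none []                    = []
advance odd  []                    = (true , 0) ∷ []
advance even []                    = (false , 1) ∷ []
advance even ((o , c) ∷ g)         = (o , suc c) ∷ advance none g
advance odd  ((true , c) ∷ g)      = (true , c) ∷ advance odd g
advance odd  ((false , zero) ∷ g)  = (true , 0) ∷ advance none g
advance odd  ((false , suc c) ∷ g) = (true , c) ∷ advance even g
advance none ((true , c) ∷ g)      = (false , c) ∷ advance odd g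
advance none ((false , zero) ∷ g)  = (false , 0) ∷ advance none g
advance none ((false , suc c) ∷ g) = (false , c) ∷ advance even g

-- The room ρ is the capacity r minus the number of even parts selected in the previous column.
greedy : ℕ → ℕ → List Good → ℕ
greedy r ρ []            = 0
greedy r ρ ((o , c) ∷ g) =
  (val o ⊓ ρ) + (c ⊓ (ρ ∸ val o) + greedy r (r ∸ c ⊓ (ρ ∸ val o)) g)

fill : ℕ → ℕ → List Good → ℕ
fill r m g = m + greedy r (r ∸ m) g

-- All bad parts of a column share mark 1, so together they occupy a single mark, however many there
-- are.
bad : ℕ → Bool → ℕ
bad zero    b = val b
bad (suc _) _ = 1

-- The parts of even size with mark at most `r`, which are those that restrict the next column. The
-- cap `r ∸ bad n b`, in place of a reduced room, is the effect of the exception in rule (d).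
accepted : ℕ → ℕ → Col → ℕ
accepted r ρ (col o n b c) = val b + (c ⊓ (ρ ∸ val o) ⊓ (r ∸ bad n b))

greedyC : ℕ → ℕ → List Col → ℕ
greedyC r ρ []                   = 0
greedyC r ρ (col o n b c ∷ cs) =
  (val o ⊓ ρ) + (n + (accepted r ρ (col o n b c)
                      + greedyC r (r ∸ accepted r ρ (col o n b c)) cs))

-- Each field compares the room left by the previous column before and after the move. An even part
-- leaving that column frees a place (`even₊`), an even part arriving there takes one (`none₊`), an
-- odd part leaving changes nothing (`odd₊`). In `even₀` and `odd₀` the vacated place is taken at
-- once by a part refused before, so the column is full after the move; in `noneᵣ` it selects no
-- even part at all.
record Advances (q : ℕ) (g : List Good) : Set where
  private r = suc q
  field
    even₊ : ∀ {ρ} → ρ < r → suc (greedy r ρ g) ≡ greedy r (suc ρ) (advance even g)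
    odd₊  : ∀ {ρ} → ρ < r → suc (greedy r (suc ρ) g) ≡ greedy r (suc ρ) (advance odd g)
    none₊ : ∀ {ρ} → ρ < r → greedy r (suc ρ) g ≡ greedy r ρ (advance none g)
    noneᵣ : greedy r r g ≡ greedy r r (advance none g)
    even₀ : greedy r 0 g ≡ greedy r 0 (advance even g)
    odd₀  : greedy r 1 g ≡ greedy r 0 (advance odd g)

suc-∸ : ∀ {m r} → m < r → r ∸ m ≡ suc (r ∸ suc m)
suc-∸ {m} {suc r} (s≤s m≤r) = +-∸-assoc 1 m≤r

∸-< : ∀ {m r} → m < r → r ∸ suc m < r
∸-< {m} {suc r} _ = s≤s (m∸n≤m r m)

module Fill {q : ℕ} {g : List Good} (A : Advances q g) where
  open Advances A
  private r = suc q

  fill-even : ∀ {m} → m < r → fill r (suc m) g ≡ fill r m (advance even g)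
  fill-even {m} m<r rewrite suc-∸ m<r =
    trans (sym (+-suc m _)) (cong (m +_) (even₊ (∸-< m<r)))

  fill-odd : ∀ {m} → m < r → suc (fill r m g) ≡ fill r m (advance odd g)
  fill-odd {m} m<r rewrite suc-∸ m<r =
    trans (sym (+-suc m _)) (cong (m +_) (odd₊ (∸-< m<r)))

  fill-none : ∀ {m} → m < r → suc (fill r m g) ≡ fill r (suc m) (advance none g)
  fill-none {m} m<r rewrite suc-∸ m<r = cong (λ z → suc (m + z)) (none₊ (∸-< m<r))

  fill-none₀ : fill r 0 g ≡ fill r 0 (advance none g)
  fill-none₀ = noneᵣ

  fill-evenᵣ : fill r r g ≡ fill r r (advance even g)
  fill-evenᵣ rewrite n∸n≡0 q = cong (r +_) even₀

  fill-oddᵣ : suc (fill r q g) ≡ fill r r (advance odd g)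
  fill-oddᵣ rewrite n∸n≡0 q | m+n∸n≡m 1 q = cong (r +_) odd₀

  -- Since `suc (u ⊓ q)` is `suc u ⊓ r`, this removes one of `suc u` candidates; for `u` beyond `q`
  -- the column remains full.
  fill-even-⊓ : ∀ u → fill r (suc (u ⊓ q)) g ≡ fill r (u ⊓ r) (advance even g)
  fill-even-⊓ u with ≤-total u q
  ... | inj₁ u≤q rewrite m≤n⇒m⊓n≡m u≤q | m≤n⇒m⊓n≡m (m≤n⇒m≤1+n u≤q) = fill-even (s≤s u≤q)
  ... | inj₂ q≤u with m≤n⇒m<n∨m≡n q≤u
  ...   | inj₁ q<u rewrite m≥n⇒m⊓n≡n q≤u | m≥n⇒m⊓n≡n q<u = fill-evenᵣ
  ...   | inj₂ refl rewrite ⊓-idem q | m≤n⇒m⊓n≡m (n≤1+n q) = fill-even ≤-refl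

  fill-odd-⊓ : ∀ u → suc (fill r (u ⊓ q) g) ≡ fill r (u ⊓ r) (advance odd g)
  fill-odd-⊓ u with ≤-total u q
  ... | inj₁ u≤q rewrite m≤n⇒m⊓n≡m u≤q | m≤n⇒m⊓n≡m (m≤n⇒m≤1+n u≤q) = fill-odd (s≤s u≤q)
  ... | inj₂ q≤u with m≤n⇒m<n∨m≡n q≤u
  ...   | inj₁ q<u rewrite m≥n⇒m⊓n≡n q≤u | m≥n⇒m⊓n≡n q<u = fill-oddᵣ
  ...   | inj₂ refl rewrite ⊓-idem q | m≤n⇒m⊓n≡m (n≤1+n q) = fill-odd ≤-refl

⊓-< : ∀ c {ρ r} → ρ < r → c ⊓ ρ < r
⊓-< c {ρ} ρ<r = ≤-<-trans (m⊓n≤n c ρ) ρ<r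

advances : ∀ q g → Advances q g
advances q [] = record
  { even₊ = λ {ρ} _ → refl ; odd₊ = λ _ → refl ; none₊ = λ _ → refl
  ; noneᵣ = refl ; even₀ = refl ; odd₀ = refl }
advances q ((true , c) ∷ g) = record
  { even₊ = even₊′ ; odd₊ = λ {ρ} ρ<r → cong suc (fill-odd (⊓-< c ρ<r))
  ; none₊ = λ ρ<r → fill-odd (⊓-< c ρ<r)
  ; noneᵣ = fill-odd-⊓ c ; even₀ = even₀′ ; odd₀ = odd₀′ }
  where
  open Fill (advances q g)
  even₊′ : ∀ {ρ} → ρ < suc q → suc (greedy (suc q) ρ ((true , c) ∷ g))
    ≡ greedy (suc q) (suc ρ) (advance even ((true , c) ∷ g))
  -- The place freed by the departing even part goes to the overlined odd part, which had no room
  -- before; the even parts of this column stay unselected.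
  even₊′ {zero} _ rewrite ⊓-zeroʳ c = cong suc fill-none₀
  even₊′ {suc ρ} ρ<r = cong suc (fill-none (⊓-< c (<-trans (n<1+n ρ) ρ<r)))
  even₀′ : greedy (suc q) 0 ((true , c) ∷ g) ≡ greedy (suc q) 0 (advance even ((true , c) ∷ g))
  even₀′ rewrite ⊓-zeroʳ c = fill-none₀
  odd₀′ : greedy (suc q) 1 ((true , c) ∷ g) ≡ greedy (suc q) 0 (advance odd ((true , c) ∷ g))
  odd₀′ rewrite ⊓-zeroʳ c = fill-odd (s≤s z≤n)
advances q ((false , zero) ∷ g) = record
  { even₊ = λ _ → fill-none (s≤s z≤n) ; odd₊ = λ _ → cong suc fill-none₀
  ; none₊ = λ _ → fill-none₀
  ; noneᵣ = fill-none₀ ; even₀ = fill-none₀ ; odd₀ = fill-none₀ }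
  where open Fill (advances q g)
advances q ((false , suc c) ∷ g) = record
  { even₊ = λ ρ<r → fill-none (⊓-< (suc c) ρ<r)
  ; odd₊ = λ ρ<r → cong suc (fill-even (⊓-< c ρ<r))
  ; none₊ = λ ρ<r → fill-even (⊓-< c ρ<r)
  ; noneᵣ = fill-even-⊓ c ; even₀ = fill-none₀ ; odd₀ = odd₀′ }
  where
  open Fill (advances q g)
  odd₀′ : greedy (suc q) 1 ((false , suc c) ∷ g) ≡ greedy (suc q) 0 (advance odd ((false , suc c) ∷ g))
  odd₀′ rewrite ⊓-zeroʳ c = fill-even (s≤s z≤n)

-- Eliminating bad parts

-- A 1-marked even part blocks mark 1 for the whole next column; an odd one blocks nothing there.
roomAfter : Carry → ℕ
roomAfter even = 0
roomAfter _    = 1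

State : Set
State = List ℕ × List Good

-- The toggled part grows by 2 and lands in the next column: a plain odd part arrives as carry
-- `odd`, an overlined even part as carry `even`. The `suc` counts this part itself.
release : Carry → State → State
release x (js , g) = suc (greedy 1 (roomAfter x) g) ∷ js , advance x g

-- The overlined even part is released innermost, hence first, because it is larger than the plain
-- odd parts of its column.
drain : ℕ → Bool → State → State
drain zero    false p = p
drain zero    true  p = release even p
drain (suc n) b     p = release odd (drain n b p)

-- The first component lists the numbers j of moved parts, the last elimination first.
phi : List Col → State
phi []                   = [] , []
phi (col o n b c ∷ cs) = proj₁ (drain n b (phi cs)) , (o , c) ∷ proj₂ (drain n b (phi cs))

headCount : ℕ → ℕ → Col → List Good → ℕ
headCount r ρ (col o n b c) g = (val o ⊓ ρ) + (n + fill r (accepted r ρ (col o n b c)) g)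

module _ (q ρ : ℕ) (o : Bool) (c : ℕ) where
  private
    r = suc q
    u = c ⊓ (ρ ∸ val o)

  -- Plain odd parts that stay behind keep mark 1 occupied, so the even parts still have `q` marks.
  -- Only when the last bad part goes does this rise to `r`, which is the case `zero`.
  headCount-even : ∀ n g →
    headCount r ρ (col o n true c) g ≡ headCount r ρ (col o n false c) (advance even g)
  headCount-even zero    g = cong (λ z → (val o ⊓ ρ) + z) (Fill.fill-even-⊓ (advances q g) u)
  headCount-even (suc n) g = cong (λ z → (val o ⊓ ρ) + (suc n + z))
    (Fill.fill-even (advances q g) (s≤s (m⊓n≤n u q)))

  headCount-odd : ∀ n g →
    headCount r ρ (col o (suc n) false c) g ≡ headCount r ρ (col o n false c) (advance odd g)
  headCount-odd zero    g = cong (λ z → (val o ⊓ ρ) + z) (Fill.fill-odd-⊓ (advances q g) u)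
  headCount-odd (suc n) g = cong (λ z → (val o ⊓ ρ) + suc z)
    (trans (sym (+-suc n _)) (cong (n +_) (Fill.fill-odd (advances q g) (s≤s (m⊓n≤n u q)))))

  -- Here `m` counts the plain odd parts still awaiting elimination; the induction transfers them
  -- one by one from `n` to `m`.
  headCount-drain : ∀ n b m p →
    headCount r ρ (col o (n + m) b c) (proj₂ p) ≡ headCount r ρ (col o m false c) (proj₂ (drain n b p))
  headCount-drain zero    false m p = refl
  headCount-drain zero    true  m p = headCount-even m (proj₂ p)
  headCount-drain (suc n) b     m p = begin
    headCount r ρ (col o (suc n + m) b c) (proj₂ p)
      ≡⟨ cong (λ z → headCount r ρ (col o z b c) (proj₂ p)) (sym (+-suc n m)) ⟩
    headCount r ρ (col o (n + suc m) b c) (proj₂ p)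
      ≡⟨ headCount-drain n b (suc m) p ⟩
    headCount r ρ (col o (suc m) false c) (proj₂ (drain n b p))
      ≡⟨ headCount-odd m (proj₂ (drain n b p)) ⟩
    headCount r ρ (col o m false c) (proj₂ (drain (suc n) b p)) ∎
    where open ≡-Reasoning

phi-greedy : ∀ q cs {ρ} → ρ ≤ suc q → greedyC (suc q) ρ cs ≡ greedy (suc q) ρ (proj₂ (phi cs))
phi-greedy q [] _ = refl
phi-greedy q (col o n b c ∷ cs) {ρ} ρ≤r = begin
  greedyC r ρ (col o n b c ∷ cs)
    ≡⟨ cong (λ z → (val o ⊓ ρ) + (n + (a + z))) (phi-greedy q cs (m∸n≤m r a)) ⟩
  headCount r ρ (col o n b c) (proj₂ (phi cs))
    ≡⟨ cong (λ z → headCount r ρ (col o z b c) (proj₂ (phi cs))) (sym (+-identityʳ n)) ⟩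
  headCount r ρ (col o (n + 0) b c) (proj₂ (phi cs))
    ≡⟨ headCount-drain q ρ o c n b 0 (phi cs) ⟩
  headCount r ρ (col o 0 false c) (proj₂ (drain n b (phi cs)))
    -- Without bad parts the cap is `r` itself, and it has no effect because the room never exceeds
    -- `r`.
    ≡⟨ cong (λ z → (val o ⊓ ρ) + fill r z (proj₂ (drain n b (phi cs))))
            (m≤n⇒m⊓n≡m (≤-trans (m⊓n≤n c _) (≤-trans (m∸n≤m ρ (val o)) ρ≤r))) ⟩
  greedy r ρ ((o , c) ∷ proj₂ (drain n b (phi cs))) ∎
  where
  open ≡-Reasoning
  r = suc q
  a = accepted r ρ (col o n b c)

-- Growth of the numbers of moved parts

greedy₁-cons : ∀ h g → greedy 1 0 (h ∷ g) ≡ greedy 1 1 g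
greedy₁-cons (false , c) g rewrite ⊓-zeroʳ c = refl
greedy₁-cons (true , c)  g rewrite ⊓-zeroʳ c = refl

greedy₁-true : ∀ c g → greedy 1 1 ((true , c) ∷ g) ≡ suc (greedy 1 1 g)
greedy₁-true c g rewrite ⊓-zeroʳ c = refl

greedy₁-false : ∀ c g → greedy 1 1 ((false , suc c) ∷ g) ≡ suc (greedy 1 0 g)
greedy₁-false c g rewrite ⊓-zeroʳ c = refl

-- Proved together with `greedy₁-lip`: a selected even part interchanges the two rooms for the next
-- column, so each bound calls the other.
greedy₁-mono : ∀ g → greedy 1 0 g ≤ greedy 1 1 g
greedy₁-lip  : ∀ g → greedy 1 1 g ≤ suc (greedy 1 0 g)
greedy₁-mono [] = z≤n
greedy₁-mono (h@(true , c) ∷ g) rewrite greedy₁-cons h g = n≤1+n _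
greedy₁-mono (h@(false , zero) ∷ g) = ≤-refl
greedy₁-mono (h@(false , suc c) ∷ g) rewrite greedy₁-cons h g | greedy₁-false c g = greedy₁-lip g
greedy₁-lip [] = z≤n
greedy₁-lip (h@(true , c) ∷ g) rewrite greedy₁-cons h g = ≤-refl
greedy₁-lip (h@(false , zero) ∷ g) = n≤1+n _
greedy₁-lip (h@(false , suc c) ∷ g) rewrite greedy₁-cons h g | greedy₁-false c g = s≤s (greedy₁-mono g)

-- With `ρ` equal to `roomAfter x`, the bound is one less than the number added by a release with
-- carry `x`, so that number exceeds all earlier ones.
record Ranks (ρ : ℕ) (p : State) : Set where
  constructor ranks
  field
    descending : Linked _>_ (proj₁ p)
    positive   : All (1 ≤_) (proj₁ p)
    bounded    : All (_≤ greedy 1 ρ (proj₂ p)) (proj₁ p)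

All≤-resp : ∀ {m n js} → m ≡ n → All (_≤ m) js → All (_≤ n) js
All≤-resp refl b = b

weaken : ∀ {p} → Ranks 0 p → Ranks 1 p
weaken {_ , g} (ranks d p b) = ranks d p (All.map (λ h → ≤-trans h (greedy₁-mono g)) b)

Linked-∷ : ∀ {j js} → All (_< j) js → Linked _>_ js → Linked _>_ (j ∷ js)
Linked-∷ [] [] = [-]
Linked-∷ (x ∷ _) l = x ∷ l

Linked⁻ : ∀ {j js} → Linked _>_ (j ∷ js) → All (_< j) js × Linked _>_ js
Linked⁻ [-] = [] , []
Linked⁻ (x ∷ l) with Linked⁻ l
... | a , _ = (x ∷ All.map (λ h → <-trans h x) a) , l

release-room : ∀ x g → x ≢ none → greedy 1 1 (advance x g) ≡ suc (greedy 1 (roomAfter x) g)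
release-room none g ne = ⊥-elim (ne refl)
release-room odd  g _  = sym (Advances.odd₊ (advances 0 g) (s≤s z≤n))
release-room even g _  = sym (Advances.even₊ (advances 0 g) (s≤s z≤n))

-- With `release-room`: the new number equals the count with room 1 after the move, and is one above
-- the count without room. This gap is what makes a release recognisable.
release-room₀ : ∀ x g → x ≢ none → greedy 1 0 (advance x g) ≡ greedy 1 (roomAfter x) g
release-room₀ none g ne = ⊥-elim (ne refl)
release-room₀ odd  g _  = sym (Advances.odd₀ (advances 0 g))
release-room₀ even g _  = sym (Advances.even₀ (advances 0 g))

release-ranks : ∀ x p → x ≢ none → Ranks (roomAfter x) p → Ranks 1 (release x p)
release-ranks x (js , g) ne (ranks d p b) = ranks
  (Linked-∷ (All.map s≤s b) d) (s≤s z≤n ∷ p)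
  (All≤-resp (sym (release-room x g ne)) (≤-refl ∷ All.map m≤n⇒m≤1+n b))

drain-ranks : ∀ n b p → Ranks 0 p → Ranks 1 (drain n b p)
drain-ranks zero    false p R = weaken R
drain-ranks zero    true  p R = release-ranks even p (λ ()) R
drain-ranks (suc n) b     p R = release-ranks odd (drain n b p) (λ ()) (drain-ranks n b p R)

phi-ranks : ∀ cs → Ranks 0 (phi cs)
phi-ranks [] = ranks [] [] []
phi-ranks (col o n b c ∷ cs) with drain-ranks n b (phi cs) (phi-ranks cs)
... | ranks d p bd = ranks d p (All≤-resp (sym (greedy₁-cons (o , c) (proj₂ (drain n b (phi cs))))) bd)

-- Canonical column lists

-- Column lists without trailing empty columns represent overpartitions uniquely.
Canon : {A : Set} → A → List A → Set
Canon e []      = ⊤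
Canon e (h ∷ t) = Canon e t × (t ≡ [] → h ≢ e)

pattern ∅ = (false , 0)
pattern ∅ᶜ = col false 0 false 0

Canonical : List Good → Set
Canonical = Canon ∅

CanonicalC : List Col → Set
CanonicalC = Canon ∅ᶜ

advance-odd≢[] : ∀ {g} → advance odd g ≢ []
advance-odd≢[] {[]} ()
advance-odd≢[] {(true , _) ∷ _} ()
advance-odd≢[] {(false , zero) ∷ _} ()
advance-odd≢[] {(false , suc _) ∷ _} ()

advance-even≢[] : ∀ {g} → advance even g ≢ []
advance-even≢[] {[]} ()
advance-even≢[] {_ ∷ _} ()

advance-none≡[] : ∀ {g} → advance none g ≡ [] → g ≡ []
advance-none≡[] {[]} _ = refl
advance-none≡[] {(true , _) ∷ _} ()
advance-none≡[] {(false , zero) ∷ _} ()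
advance-none≡[] {(false , suc _) ∷ _} ()

advance-canonical : ∀ x {g} → Canonical g → Canonical (advance x g)
advance-canonical none {[]} _ = tt
advance-canonical odd  {[]} _ = tt , λ _ ()
advance-canonical even {[]} _ = tt , λ _ ()
advance-canonical even {_ ∷ g} (cg , _) = advance-canonical none cg , λ _ ()
advance-canonical odd  {(true , c) ∷ g} (cg , _) = advance-canonical odd cg , λ _ ()
advance-canonical odd  {(false , zero) ∷ g} (cg , _) = advance-canonical none cg , λ _ ()
advance-canonical odd  {(false , suc c) ∷ g} (cg , _) = advance-canonical even cg , λ _ ()
advance-canonical none {(true , c) ∷ g} (cg , _) = advance-canonical odd cg , λ e → ⊥-elim (advance-odd≢[] e)
advance-canonical none {(false , zero) ∷ g} (cg , ne) = advance-canonical none cg , λ e → ne (advance-none≡[] e)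
advance-canonical none {(false , suc c) ∷ g} (cg , _) = advance-canonical even cg , λ e → ⊥-elim (advance-even≢[] {g} e)

drain-canonical : ∀ n b {p} → Canonical (proj₂ p) → Canonical (proj₂ (drain n b p))
drain-canonical zero    false c = c
drain-canonical zero    true  c = advance-canonical even c
drain-canonical (suc n) b     c = advance-canonical odd (drain-canonical n b c)

drain≡[] : ∀ n b {p} → proj₂ (drain n b p) ≡ [] → n ≡ 0 × b ≡ false × proj₂ p ≡ []
drain≡[] zero    false e = refl , refl , e
drain≡[] zero    true {p} e = ⊥-elim (advance-even≢[] {proj₂ p} e)
drain≡[] (suc n) b     e = ⊥-elim (advance-odd≢[] e)

phi≡[] : ∀ {cs} → proj₂ (phi cs) ≡ [] → cs ≡ []
phi≡[] {[]} _ = refl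
phi≡[] {col _ _ _ _ ∷ _} ()

phi-canonical : ∀ {cs} → CanonicalC cs → Canonical (proj₂ (phi cs))
phi-canonical {[]} _ = tt
phi-canonical {col o n b c ∷ cs} (ccs , ne) =
  drain-canonical n b (phi-canonical {cs} ccs) , λ e e′ → lemma (drain≡[] n b e) e′
  where
  lemma : n ≡ 0 × b ≡ false × proj₂ (phi cs) ≡ [] → (o , c) ≢ ∅
  lemma (refl , refl , e) refl = ne (phi≡[] e) refl

-- Undoing a move, and injectivity

-- When the moved part was the only one in the last column, taking it back would leave an empty
-- column there; it is dropped to stay canonical.
trim : Good → List Good → List Good
trim h             (x ∷ g) = h ∷ x ∷ g
trim (true , c)    []      = (true , c) ∷ []
trim (false , suc c) []    = (false , suc c) ∷ []
trim (false , zero) []     = []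

-- From the right, the moved part of a column is an even one if the next column contains no
-- moved part, and otherwise (or if there is no even part) the odd one.
retractCol : Carry → Bool → ℕ → List Good → Carry × List Good
retractCol none o     (suc c) g = even , trim (o , c) g
retractCol none true  zero    g = odd  , trim ∅ g
retractCol none false zero    g = none , ∅ ∷ g
retractCol odd  true  c       g = odd  , (true , c) ∷ g
retractCol odd  false c       g = none , (true , c) ∷ g
retractCol even true  c       g = odd  , (false , suc c) ∷ g
retractCol even false c       g = none , (false , suc c) ∷ g

retract : List Good → Carry × List Good
retract []            = none , []
retract ((o , c) ∷ g) = retractCol (proj₁ (retract g)) o c (proj₂ (retract g))

trim-canonical : ∀ h {g} → Canonical (h ∷ g) → trim h g ≡ h ∷ g
trim-canonical h {x ∷ g} _ = refl
trim-canonical (true , c) {[]} _ = refl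
trim-canonical (false , suc c) {[]} _ = refl
trim-canonical (false , zero) {[]} (_ , ne) = ⊥-elim (ne refl refl)

retract-advance : ∀ x {g} → Canonical g → retract (advance x g) ≡ (x , g)
retract-advance none {[]} _ = refl
retract-advance odd  {[]} _ = refl
retract-advance even {[]} _ = refl
retract-advance even {h ∷ g} cg rewrite retract-advance none {g} (proj₁ cg) =
  cong (even ,_) (trim-canonical h cg)
retract-advance odd  {(true , c) ∷ g} (cg , _) rewrite retract-advance odd {g} cg = refl
retract-advance odd  {(false , zero) ∷ g} cg rewrite retract-advance none {g} (proj₁ cg) =
  cong (odd ,_) (trim-canonical ∅ cg)
retract-advance odd  {(false , suc c) ∷ g} (cg , _) rewrite retract-advance even {g} cg = refl
retract-advance none {(true , c) ∷ g} (cg , _) rewrite retract-advance odd {g} cg = refl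
retract-advance none {(false , zero) ∷ g} (cg , _) rewrite retract-advance none {g} cg = refl
retract-advance none {(false , suc c) ∷ g} (cg , _) rewrite retract-advance even {g} cg = refl

advance-trim : ∀ x h g → x ≢ none → advance x (trim h g) ≡ advance x (h ∷ g)
advance-trim x h (_ ∷ g) _ = refl
advance-trim x (true , c) [] _ = refl
advance-trim x (false , suc c) [] _ = refl
advance-trim none (false , zero) [] ne = ⊥-elim (ne refl)
advance-trim odd  (false , zero) [] _ = refl
advance-trim even (false , zero) [] _ = refl

-- Every list is the outcome of a move, with carry `none` if nothing entered from the left, so
-- undoing never gets stuck.
advance-retract : ∀ g → advance (proj₁ (retract g)) (proj₂ (retract g)) ≡ g
advance-retract [] = refl
advance-retract ((o , c) ∷ g) with retract g | advance-retract g
advance-retract ((o , suc c) ∷ g)     | none , g′ | refl = advance-trim even (o , c) g′ (λ ())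
advance-retract ((true , zero) ∷ g)   | none , g′ | refl = advance-trim odd ∅ g′ (λ ())
advance-retract ((false , zero) ∷ g)  | none , g′ | refl = refl
advance-retract ((true , c) ∷ g)   | odd , g′  | refl = refl
advance-retract ((false , c) ∷ g)  | odd , g′  | refl = refl
advance-retract ((true , c) ∷ g)   | even , g′ | refl = refl
advance-retract ((false , c) ∷ g)  | even , g′ | refl = refl

Canonical-trim : ∀ h {g} → Canonical g → Canonical (trim h g)
Canonical-trim h {x ∷ g} cg = cg , λ ()
Canonical-trim (true , c) {[]} _ = tt , λ _ ()
Canonical-trim (false , suc c) {[]} _ = tt , λ _ ()
Canonical-trim (false , zero) {[]} _ = tt

retract-canonical : ∀ g → Canonical g → Canonical (proj₂ (retract g))
retract-canonical [] _ = tt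
retract-canonical ((o , c) ∷ g) (cg , ne)
  with retract g | advance-retract g | retract-canonical g cg
retract-canonical ((o , suc c) ∷ g)     (cg , ne) | none , g′ | refl | h = Canonical-trim (o , c) h
retract-canonical ((true , zero) ∷ g)   (cg , ne) | none , g′ | refl | h = Canonical-trim ∅ h
retract-canonical ((false , zero) ∷ g)  (cg , ne) | none , g′ | refl | h =
  h , λ e → ne (cong (advance none) e)
retract-canonical ((true , c) ∷ g)   (cg , ne) | odd , g′  | refl | h = h , λ _ ()
retract-canonical ((false , c) ∷ g)  (cg , ne) | odd , g′  | refl | h = h , λ _ ()
retract-canonical ((true , c) ∷ g)   (cg , ne) | even , g′ | refl | h = h , λ _ ()
retract-canonical ((false , c) ∷ g)  (cg , ne) | even , g′ | refl | h = h , λ _ ()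

-- Undoing a move does not lengthen the list, which bounds the recursion in `phi-surjective`.
length-advance : ∀ x g → length g ≤ length (advance x g)
length-advance none [] = z≤n
length-advance odd  [] = z≤n
length-advance even [] = z≤n
length-advance even (_ ∷ g) = s≤s (length-advance none g)
length-advance odd  ((true , c) ∷ g) = s≤s (length-advance odd g)
length-advance odd  ((false , zero) ∷ g) = s≤s (length-advance none g)
length-advance odd  ((false , suc c) ∷ g) = s≤s (length-advance even g)
length-advance none ((true , c) ∷ g) = s≤s (length-advance odd g)
length-advance none ((false , zero) ∷ g) = s≤s (length-advance none g)
length-advance none ((false , suc c) ∷ g) = s≤s (length-advance even g)

advance-injective : ∀ {x y g h} → Canonical g → Canonical h →
  advance x g ≡ advance y h → (x , g) ≡ (y , h)
advance-injective {x} {y} cg ch e =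
  trans (sym (retract-advance x cg)) (trans (cong retract e) (retract-advance y ch))

release-injective : ∀ {x y p q} → Canonical (proj₂ p) → Canonical (proj₂ q) →
  release x p ≡ release y q → x ≡ y × p ≡ q
release-injective {p = js , g} {js′ , g′} cp cq e
  with advance-injective cp cq (cong proj₂ e) | cong proj₁ e
... | refl | refl = refl , refl

-- The newest number lies above the count without room. This separates a state just released from
-- one left untouched by the present column.
¬ranks-release : ∀ x p → x ≢ none → ¬ Ranks 0 (release x p)
¬ranks-release x (js , g) ne (ranks _ _ (b ∷ _)) = 1+n≰n (≤-trans b (≤-reflexive (release-room₀ x g ne)))

drain-injective : ∀ n n′ b b′ {p p′} →
  Canonical (proj₂ p) → Canonical (proj₂ p′) → Ranks 0 p → Ranks 0 p′ →
  drain n b p ≡ drain n′ b′ p′ → n ≡ n′ × b ≡ b′ × p ≡ p′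
drain-injective zero zero false false _ _ _ _ e = refl , refl , e
drain-injective zero zero true true c c′ _ _ e = refl , refl , proj₂ (release-injective {even} {even} c c′ e)
drain-injective zero zero false true {p} {p′} _ _ r _ refl = ⊥-elim (¬ranks-release even p′ (λ ()) r)
drain-injective zero zero true false {p} _ _ _ r refl = ⊥-elim (¬ranks-release even p (λ ()) r)
drain-injective zero (suc n) false b′ _ _ r _ refl = ⊥-elim (¬ranks-release odd _ (λ ()) r)
drain-injective (suc n) zero b false _ _ _ r refl = ⊥-elim (¬ranks-release odd _ (λ ()) r)
drain-injective zero (suc n) true b′ c c′ _ _ e
  with release-injective {even} {odd} c (drain-canonical n b′ c′) e
... | () , _
drain-injective (suc n) zero b true c c′ _ _ e
  with release-injective {odd} {even} (drain-canonical n b c) c′ e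
... | () , _
drain-injective (suc n) (suc n′) b b′ c c′ r r′ e
  with drain-injective n n′ b b′ c c′ r r′
         (proj₂ (release-injective {odd} {odd} (drain-canonical n b c) (drain-canonical n′ b′ c′) e))
... | refl , e₂ , e₃ = refl , e₂ , e₃

phi-injective : ∀ cs cs′ → CanonicalC cs → CanonicalC cs′ → phi cs ≡ phi cs′ → cs ≡ cs′
phi-injective [] cs′ _ _ e = sym (phi≡[] (cong proj₂ (sym e)))
phi-injective (_ ∷ _) [] _ _ e = phi≡[] (cong proj₂ e)
phi-injective (col o n b c ∷ cs) (col o′ n′ b′ c′ ∷ cs′) (k , _) (k′ , _) e
  with ∷-injective (cong proj₂ e) | cong proj₁ e
... | refl , e₂ | e₁
  with drain-injective n n′ b b′ (phi-canonical {cs} k) (phi-canonical {cs′} k′)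
         (phi-ranks cs) (phi-ranks cs′) (cong₂ _,_ e₁ e₂)
... | refl , refl , e₃ = cong (col o n b c ∷_) (phi-injective cs cs′ k k′ e₃)

-- Surjectivity of the elimination

record Undrained (p : State) : Set where
  constructor undrained
  field
    n          : ℕ
    bar        : Bool
    source     : State
    drains     : drain n bar source ≡ p
    admissible : Ranks 0 source
    canonical  : Canonical (proj₂ source)
    shorter    : length (proj₂ source) ≤ length (proj₂ p)

rank-of-advance : ∀ x {j} g → x ≢ none → j ≤ greedy 1 1 (advance x g) → ¬ j ≤ greedy 1 0 (advance x g) →
  j ≡ suc (greedy 1 (roomAfter x) g)
rank-of-advance x {j} g ne j≤ j≰ = ≤-antisym (subst (j ≤_) (release-room x g ne) j≤)
  (subst (_< j) (release-room₀ x g ne) (≰⇒> j≰))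

ranks-tail : ∀ {j js g g′} x → Ranks 1 (j ∷ js , g) → j ≡ suc (greedy 1 (roomAfter x) g′) →
  Ranks (roomAfter x) (js , g′)
ranks-tail x (ranks d p _) refl = ranks (proj₂ (Linked⁻ d)) (All.tail p) (All.map s≤s⁻¹ (proj₁ (Linked⁻ d)))

-- The newest number decides. If it is at most the count without room, no release belongs to this
-- column. Otherwise it is exactly one more, and the carry found by `retract` tells which kind of
-- part was released; an overlined even part is always the first release of its column, so the
-- search ends there.
undrain : ∀ js g → Canonical g → Ranks 1 (js , g) → Undrained (js , g)
undrain [] g cg _ = undrained 0 false ([] , g) refl (ranks [] [] []) cg ≤-refl
undrain (j ∷ js) g cg R@(ranks d p b) with j ≤? greedy 1 0 g
... | yes j≤ = undrained 0 false (j ∷ js , g) refl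
  (ranks d p (j≤ ∷ All.map (λ i<j → ≤-trans (<⇒≤ i<j) j≤) (proj₁ (Linked⁻ d)))) cg ≤-refl
... | no j≰ with retract g | advance-retract g | retract-canonical g cg
-- After a move with carry `none` the counts with and without room agree, so no number lies between
-- them.
... | none , g′ | refl | cg′ = ⊥-elim (j≰ (subst (j ≤_)
        (trans (sym (Advances.noneᵣ (advances 0 g′))) (Advances.none₊ (advances 0 g′) (s≤s z≤n))) (All.head b)))
... | even , g′ | refl | cg′ =
  undrained 0 true (js , g′) (cong (λ z → z ∷ js , g) (sym j≡)) (ranks-tail even R j≡) cg′ (length-advance even g′)
  where j≡ = rank-of-advance even g′ (λ ()) (All.head b) j≰
... | odd , g′ | refl | cg′ = undrained (suc n) bar source
  (trans (cong (release odd) drains) (cong (λ z → z ∷ js , g) (sym j≡)))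
  admissible canonical (≤-trans shorter (length-advance odd g′))
  where
  j≡ = rank-of-advance odd g′ (λ ()) (All.head b) j≰
  open Undrained (undrain js g′ cg′ (ranks-tail odd R j≡))

Preimage : State → Set
Preimage p = ∃ λ cs → phi cs ≡ p × CanonicalC cs

cons-preimage : ∀ {js o c g} → Canonical ((o , c) ∷ g) → (u : Undrained (js , g)) →
  (pre : Preimage (Undrained.source u)) →
  phi (col o (Undrained.n u) (Undrained.bar u) c ∷ proj₁ pre) ≡ (js , (o , c) ∷ g)
  × CanonicalC (col o (Undrained.n u) (Undrained.bar u) c ∷ proj₁ pre)
cons-preimage {js} {o} {c} {g} cg (undrained n b s refl a cs sh) (ds , refl , cds) =
  refl , cds , ne
  where
  ne : ds ≡ [] → col o n b c ≢ ∅ᶜ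
  ne refl refl = proj₂ cg refl refl

-- Fuel bounds the length, since the state recovered by `undrain` is not a structural part of `g`
-- but merely no longer than its tail.
phi-surjective : ∀ fuel js g → length g ≤ fuel → Canonical g → Ranks 0 (js , g) → Preimage (js , g)
phi-surjective fuel []       [] _ _ _ = [] , refl , tt
phi-surjective fuel (j ∷ js) [] _ _ (ranks _ (p ∷ _) (b ∷ _)) = ⊥-elim (1+n≰n (≤-trans p b))
phi-surjective (suc fuel) js ((o , c) ∷ g) (s≤s l) cg (ranks d p b) = _ , cons-preimage cg u pre
  where
  u = undrain js g (proj₁ cg) (ranks d p (All≤-resp (greedy₁-cons (o , c) g) b))
  open Undrained u
  pre : Preimage source
  pre = phi-surjective fuel (proj₁ source) (proj₂ source) (≤-trans shorter l) canonical admissible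

-- The smallest part

StartOK : List Col → Set
StartOK []                             = ⊥
StartOK (col true _ _ _ ∷ _)           = ⊤
StartOK (col false (suc _) _ _ ∷ _)    = ⊥
StartOK (col false 0 true _ ∷ _)       = ⊥
StartOK (col false 0 false (suc _) ∷ _) = ⊤
StartOK (col false 0 false 0 ∷ cs)     = StartOK cs

up : Good → Col
up (o , c) = col o 0 false c

ups : List Good → List Col
ups []      = []
ups (h ∷ g) = up h ∷ ups g

phi-start : ∀ cs → StartOK cs → StartOK (ups (proj₂ (phi cs)))
phi-start (col true _ _ _ ∷ cs) _ = tt
phi-start (col false 0 false (suc c) ∷ cs) _ = tt
phi-start (col false 0 false 0 ∷ cs) h = phi-start cs h

-- The first 1-marked part is never moved.
ranks-start : ∀ cs → StartOK cs → All (_< greedy 1 1 (proj₂ (phi cs))) (proj₁ (phi cs))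
ranks-start (col true n b c ∷ cs) _
  rewrite greedy₁-true c (proj₂ (drain n b (phi cs))) =
  All.map s≤s (Ranks.bounded (drain-ranks n b (phi cs) (phi-ranks cs)))
ranks-start (col false 0 false (suc c) ∷ cs) _
  rewrite greedy₁-false c (proj₂ (phi cs)) = All.map s≤s (Ranks.bounded (phi-ranks cs))
ranks-start (col false 0 false 0 ∷ cs) h = ranks-start cs h

-- The strict bound fits the first nonempty column. Behind an overlined odd part it leaves
-- `Ranks 1`, so bad parts may be restored in that column; if the column starts with an even part it
-- leaves `Ranks 0`, so none are.
phi-surjective-start : ∀ js g → Canonical g → StartOK (ups g) →
  Linked _>_ js → All (1 ≤_) js → All (_< greedy 1 1 g) js →
  ∃ λ cs → phi cs ≡ (js , g) × CanonicalC cs × StartOK cs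
phi-surjective-start js ((true , c) ∷ g) cg _ d p b
  rewrite greedy₁-true c g = _ , proj₁ pre , proj₂ pre , tt
  where
  u = undrain js g (proj₁ cg) (ranks d p (All.map s≤s⁻¹ b))
  open Undrained u
  pre = cons-preimage cg u (phi-surjective _ (proj₁ source) (proj₂ source) ≤-refl canonical admissible)
phi-surjective-start js ((false , suc c) ∷ g) cg _ d p b
  rewrite greedy₁-false c g = _ , proj₁ pre , proj₂ pre , tt
  where
  a : Ranks 0 (js , g)
  a = ranks d p (All.map s≤s⁻¹ b)
  pre = cons-preimage cg (undrained 0 false (js , g) refl a (proj₁ cg) ≤-refl)
          (phi-surjective _ js g ≤-refl (proj₁ cg) a)
phi-surjective-start js ((false , zero) ∷ g) (cg , ne) s d p b
  with phi-surjective-start js g cg s d p b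
... | cs , refl , c , s′ = col false 0 false 0 ∷ cs , refl , (c , λ {refl _ → s}) , s′

-- Sizes and numbers of parts

colParts : ℕ → Col → List Part → List Part
colParts a (col o n b c) rest =
  replicate (val o) (1 + a , true) ++ replicate n (1 + a , false) ++
  replicate (val b) (2 + a , true) ++ replicate c (2 + a , false) ++ rest

parts : ℕ → List Col → List Part
parts a []       = []
parts a (h ∷ cs) = colParts a h (parts (2 + a) cs)

weight : ℕ → List Good → ℕ
weight a []            = 0
weight a ((o , c) ∷ g) = val o * (1 + a) + c * (2 + a) + weight (2 + a) g

weightC : ℕ → List Col → ℕ
weightC a []                   = 0
weightC a (col o n b c ∷ cs) =
  val o * (1 + a) + (n * (1 + a) + (val b * (2 + a) + (c * (2 + a) + weightC (2 + a) cs)))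

number : List Good → ℕ
number []            = 0
number ((o , c) ∷ g) = val o + c + number g

numberC : List Col → ℕ
numberC []                   = 0
numberC (col o n b c ∷ cs) = val o + (n + (val b + (c + numberC cs)))

weightC-ups : ∀ a g → weightC a (ups g) ≡ weight a g
weightC-ups a [] = refl
weightC-ups a ((o , c) ∷ g) rewrite weightC-ups (2 + a) g = sym (+-assoc (val o * (1 + a)) _ _)

numberC-ups : ∀ g → numberC (ups g) ≡ number g
numberC-ups [] = refl
numberC-ups ((o , c) ∷ g) rewrite numberC-ups g = sym (+-assoc (val o) c _)

greedyC-ups : ∀ r {ρ} → ρ ≤ r → ∀ g → greedyC r ρ (ups g) ≡ greedy r ρ g
greedyC-ups r ρ≤r [] = refl
greedyC-ups r {ρ} ρ≤r ((o , c) ∷ g)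
  rewrite m≤n⇒m⊓n≡m (≤-trans (m⊓n≤n c _) (≤-trans (m∸n≤m ρ (val o)) ρ≤r))
        | greedyC-ups r (m∸n≤m r (c ⊓ (ρ ∸ val o))) g = refl

-- The size of the incoming part on arrival, the 2 already added.
carryWeight : ℕ → Carry → ℕ
carryWeight a none = 0
carryWeight a odd  = 1 + a
carryWeight a even = 2 + a

-- The capacity-one greedy count is the number of 1-marked parts, each of which grows by 2.
advance-weight : ∀ a x g →
  weight a (advance x g) ≡ weight a g + carryWeight a x + 2 * greedy 1 (roomAfter x) g
advance-weight a none [] = refl
advance-weight a odd  [] = lemma a
  where
  lemma : ∀ a → 1 * (1 + a) + 0 + 0 ≡ 1 + a + 0
  lemma = solve-∀
advance-weight a even [] = lemma a
  where
  lemma : ∀ a → 0 + 1 * (2 + a) + 0 ≡ 2 + a + 0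
  lemma = solve-∀
advance-weight a even ((o , c) ∷ g)
  rewrite greedy₁-cons (o , c) g | advance-weight (2 + a) none g =
  lemma a (val o) c (weight (2 + a) g) (greedy 1 1 g)
  where
  lemma : ∀ a o c w u → o * (1 + a) + suc c * (2 + a) + (w + 0 + 2 * u)
    ≡ o * (1 + a) + c * (2 + a) + w + (2 + a) + 2 * u
  lemma = solve-∀
advance-weight a odd ((true , c) ∷ g)
  rewrite ⊓-zeroʳ c | advance-weight (2 + a) odd g =
  lemma a c (weight (2 + a) g) (greedy 1 1 g)
  where
  lemma : ∀ a c w u → 1 * (1 + a) + c * (2 + a) + (w + (1 + (2 + a)) + 2 * u)
    ≡ 1 * (1 + a) + c * (2 + a) + w + (1 + a) + 2 * (1 + u)
  lemma = solve-∀
advance-weight a odd ((false , zero) ∷ g)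
  rewrite advance-weight (2 + a) none g = lemma a (weight (2 + a) g) (greedy 1 1 g)
  where
  lemma : ∀ a w u → 1 * (1 + a) + 0 + (w + 0 + 2 * u) ≡ w + (1 + a) + 2 * u
  lemma = solve-∀
advance-weight a odd ((false , suc c) ∷ g)
  rewrite ⊓-zeroʳ c | advance-weight (2 + a) even g =
  lemma a c (weight (2 + a) g) (greedy 1 0 g)
  where
  lemma : ∀ a c w u → 1 * (1 + a) + c * (2 + a) + (w + (2 + (2 + a)) + 2 * u)
    ≡ 0 + suc c * (2 + a) + w + (1 + a) + 2 * (1 + u)
  lemma = solve-∀
advance-weight a none ((true , c) ∷ g)
  rewrite ⊓-zeroʳ c | advance-weight (2 + a) odd g =
  lemma a c (weight (2 + a) g) (greedy 1 1 g)
  where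
  lemma : ∀ a c w u → 0 + c * (2 + a) + (w + (1 + (2 + a)) + 2 * u)
    ≡ 1 * (1 + a) + c * (2 + a) + w + 0 + 2 * (1 + u)
  lemma = solve-∀
advance-weight a none ((false , zero) ∷ g) = advance-weight (2 + a) none g
advance-weight a none ((false , suc c) ∷ g)
  rewrite ⊓-zeroʳ c | advance-weight (2 + a) even g =
  lemma a c (weight (2 + a) g) (greedy 1 0 g)
  where
  lemma : ∀ a c w u → 0 + c * (2 + a) + (w + (2 + (2 + a)) + 2 * u)
    ≡ 0 + suc c * (2 + a) + w + 0 + 2 * (1 + u)
  lemma = solve-∀

-- A bad part enters the next column with its size increased by 2, and 2 is added to every later
-- moved part, so each release adds twice its number. Old and new sums stand on opposite sides to
-- avoid subtraction.
drain-weight : ∀ a n b p →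
  weight (2 + a) (proj₂ (drain n b p)) + 2 * sum (proj₁ p)
  ≡ n * (1 + a) + (val b * (2 + a) + weight (2 + a) (proj₂ p)) + 2 * sum (proj₁ (drain n b p))
drain-weight a zero    false p = refl
drain-weight a zero    true  (js , g) rewrite advance-weight (2 + a) even g =
  lemma a (weight (2 + a) g) (greedy 1 0 g) (sum js)
  where
  lemma : ∀ a w u s → w + (2 + (2 + a)) + 2 * u + 2 * s ≡ 1 * (2 + a) + w + 2 * (1 + u + s)
  lemma = solve-∀
drain-weight a (suc n) b p with drain n b p | drain-weight a n b p
... | js , g | e rewrite advance-weight (2 + a) odd g = begin
  weight (2 + a) g + (1 + (2 + a)) + 2 * greedy 1 1 g + 2 * sum (proj₁ p)
    ≡⟨ lemma₁ a (weight (2 + a) g) (greedy 1 1 g) (sum (proj₁ p)) ⟩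
  weight (2 + a) g + 2 * sum (proj₁ p) + (1 + a + 2 * suc (greedy 1 1 g))
    ≡⟨ cong (_+ (1 + a + 2 * suc (greedy 1 1 g))) e ⟩
  n * (1 + a) + (val b * (2 + a) + weight (2 + a) (proj₂ p)) + 2 * sum js + (1 + a + 2 * suc (greedy 1 1 g))
    ≡⟨ lemma₂ a n (val b * (2 + a) + weight (2 + a) (proj₂ p)) (greedy 1 1 g) (sum js) ⟩
  suc n * (1 + a) + (val b * (2 + a) + weight (2 + a) (proj₂ p)) + 2 * (suc (greedy 1 1 g) + sum js) ∎
  where
  open ≡-Reasoning
  lemma₁ : ∀ a w u s → w + (1 + (2 + a)) + 2 * u + 2 * s ≡ w + 2 * s + (1 + a + 2 * (1 + u))
  lemma₁ = solve-∀
  lemma₂ : ∀ a n v u s → n * (1 + a) + v + 2 * s + (1 + a + 2 * (1 + u)) ≡ (1 + n) * (1 + a) + v + 2 * (1 + u + s)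
  lemma₂ = solve-∀

phi-weight : ∀ a cs → weight a (proj₂ (phi cs)) ≡ weightC a cs + 2 * sum (proj₁ (phi cs))
phi-weight a [] = refl
phi-weight a (col o n b c ∷ cs) = +-cancelʳ-≡ (2 * t) _ _ (begin
  val o * (1 + a) + c * (2 + a) + weight (2 + a) (proj₂ p) + 2 * t
    ≡⟨ +-assoc (val o * (1 + a) + c * (2 + a)) _ _ ⟩
  val o * (1 + a) + c * (2 + a) + (weight (2 + a) (proj₂ p) + 2 * t)
    ≡⟨ cong (val o * (1 + a) + c * (2 + a) +_) (drain-weight a n b (phi cs)) ⟩
  val o * (1 + a) + c * (2 + a) + (n * (1 + a) + (val b * (2 + a) + weight (2 + a) (proj₂ (phi cs))) + 2 * sum (proj₁ p))
    ≡⟨ cong (λ z → val o * (1 + a) + c * (2 + a) + (n * (1 + a) + (val b * (2 + a) + z) + 2 * sum (proj₁ p)))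
         (phi-weight (2 + a) cs) ⟩
  val o * (1 + a) + c * (2 + a) + (n * (1 + a) + (val b * (2 + a) + (weightC (2 + a) cs + 2 * t)) + 2 * sum (proj₁ p))
    ≡⟨ lemma (val o * (1 + a)) (c * (2 + a)) (n * (1 + a)) (val b * (2 + a)) (weightC (2 + a) cs) t (sum (proj₁ p)) ⟩
  weightC a (col o n b c ∷ cs) + 2 * sum (proj₁ p) + 2 * t ∎)
  where
  open ≡-Reasoning
  p = drain n b (phi cs)
  t = sum (proj₁ (phi cs))
  lemma : ∀ o c n b w t s → o + c + (n + (b + (w + 2 * t)) + 2 * s) ≡ o + (n + (b + (c + w))) + 2 * s + 2 * t
  lemma = solve-∀

carryNumber : Carry → ℕ
carryNumber none = 0
carryNumber _    = 1

advance-number : ∀ x g → number (advance x g) ≡ carryNumber x + number g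
advance-number none [] = refl
advance-number odd  [] = refl
advance-number even [] = refl
advance-number even ((o , c) ∷ g) rewrite advance-number none g | +-suc (val o) c = refl
advance-number odd  ((true , c) ∷ g) rewrite advance-number odd g = cong suc (+-suc c _)
advance-number odd  ((false , zero) ∷ g) rewrite advance-number none g = refl
advance-number odd  ((false , suc c) ∷ g) rewrite advance-number even g = cong suc (+-suc c _)
advance-number none ((true , c) ∷ g) rewrite advance-number odd g = +-suc c _
advance-number none ((false , zero) ∷ g) rewrite advance-number none g = refl
advance-number none ((false , suc c) ∷ g) rewrite advance-number even g = +-suc c _

drain-number : ∀ n b p → number (proj₂ (drain n b p)) ≡ n + (val b + number (proj₂ p))
drain-number zero    false p = refl
drain-number zero    true  p = advance-number even (proj₂ p)
drain-number (suc n) b     p =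
  trans (advance-number odd (proj₂ (drain n b p))) (cong suc (drain-number n b p))

phi-number : ∀ cs → number (proj₂ (phi cs)) ≡ numberC cs
phi-number [] = refl
phi-number (col o n b c ∷ cs) rewrite drain-number n b (phi cs) | phi-number cs =
  lemma (val o) c n (val b) (numberC cs)
  where
  lemma : ∀ o c n b w → o + c + (n + (b + w)) ≡ o + (n + (b + (c + w)))
  lemma = solve-∀

total-replicate : ∀ n p {ys v} → total ys ≡ v → total (replicate n p ++ ys) ≡ n * size p + v
total-replicate zero    p e = e
total-replicate (suc n) p {_} {v} e =
  trans (cong (size p +_) (total-replicate n p e)) (sym (+-assoc (size p) (n * size p) v))

total-parts : ∀ a cs → total (parts a cs) ≡ weightC a cs
total-parts a [] = refl
total-parts a (col o n b c ∷ cs) =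
  total-replicate (val o) (1 + a , true) (total-replicate n (1 + a , false)
    (total-replicate (val b) (2 + a , true) (total-replicate c (2 + a , false)
      (total-parts (2 + a) cs))))

length-replicate-++ : ∀ n (p : Part) {ys v} → length ys ≡ v → length (replicate n p ++ ys) ≡ n + v
length-replicate-++ zero    p e = e
length-replicate-++ (suc n) p e = cong suc (length-replicate-++ n p e)

length-parts : ∀ a cs → length (parts a cs) ≡ numberC cs
length-parts a [] = refl
length-parts a (col o n b c ∷ cs) =
  length-replicate-++ (val o) (1 + a , true) (length-replicate-++ n (1 + a , false)
    (length-replicate-++ (val b) (2 + a , true) (length-replicate-++ c (2 + a , false)
      (length-parts (2 + a) cs))))

-- Columns and overpartitions

shift : Part → Part
shift (s , β) = (2 + s , β)

map-shift-replicate : ∀ n p {ys zs} → map shift ys ≡ zs →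
  map shift (replicate n p ++ ys) ≡ replicate n (shift p) ++ zs
map-shift-replicate zero    p e = e
map-shift-replicate (suc n) p e = cong (shift p ∷_) (map-shift-replicate n p e)

parts-shift : ∀ a cs → map shift (parts a cs) ≡ parts (2 + a) cs
parts-shift a [] = refl
parts-shift a (col o n b c ∷ cs) =
  map-shift-replicate (val o) (1 + a , true) (map-shift-replicate n (1 + a , false)
    (map-shift-replicate (val b) (2 + a , true) (map-shift-replicate c (2 + a , false)
      (parts-shift (2 + a) cs))))

-- Order of consecutive parts of an overpartition: a part may only be followed by an
-- equally large one if the latter is not overlined.
_⊴_ : Part → Part → Set
p ⊴ q = size p < size q ⊎ (size p ≡ size q × proj₂ q ≡ false)

addTo : ℕ → Bool → Col → List Col → List Col
add   : ℕ → Bool → List Col → List Col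
addTo 0                   _     h               cs = h ∷ cs
addTo 1                   true  (col o n b c) cs = col true n b c ∷ cs
addTo 1                   false (col o n b c) cs = col o (suc n) b c ∷ cs
addTo 2                   true  (col o n b c) cs = col o n true c ∷ cs
addTo 2                   false (col o n b c) cs = col o n b (suc c) ∷ cs
addTo (suc (suc (suc s))) β     h             cs = h ∷ add (suc s) β cs
add s β []       = addTo s β ∅ᶜ []
add s β (h ∷ cs) = addTo s β h cs

columns : List Part → List Col
columns []             = []
columns ((s , β) ∷ ps) = add s β (columns ps)

-- A new smallest part can only enter a column whose earlier fields are empty; the order hypothesis
-- on the first listed part refutes every other case.
parts-addTo : ∀ d β h cs → All ((suc d , β) ⊴_) (parts 0 (h ∷ cs)) →
  parts 0 (addTo (suc d) β h cs) ≡ (suc d , β) ∷ parts 0 (h ∷ cs)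
parts-add : ∀ d β cs → All ((suc d , β) ⊴_) (parts 0 cs) →
  parts 0 (add (suc d) β cs) ≡ (suc d , β) ∷ parts 0 cs
parts-addTo 0 _     (col true n b c) cs (inj₁ (s≤s ()) ∷ _)
parts-addTo 0 _     (col true n b c) cs (inj₂ (_ , ()) ∷ _)
parts-addTo 0 true  (col false n b c) cs _ = refl
parts-addTo 0 false (col false n b c) cs _ = refl
parts-addTo 1 _     (col true n b c) cs (inj₁ (s≤s ()) ∷ _)
parts-addTo 1 _     (col true n b c) cs (inj₂ (() , _) ∷ _)
parts-addTo 1 _     (col false (suc n) b c) cs (inj₁ (s≤s ()) ∷ _)
parts-addTo 1 _     (col false (suc n) b c) cs (inj₂ (() , _) ∷ _)
parts-addTo 1 _     (col false 0 true c) cs (inj₁ (s≤s (s≤s ())) ∷ _)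
parts-addTo 1 _     (col false 0 true c) cs (inj₂ (_ , ()) ∷ _)
parts-addTo 1 true  (col false 0 false c) cs _ = refl
parts-addTo 1 false (col false 0 false c) cs _ = refl
parts-addTo (suc (suc d)) _ (col true n b c) cs (inj₁ (s≤s ()) ∷ _)
parts-addTo (suc (suc d)) _ (col true n b c) cs (inj₂ (() , _) ∷ _)
parts-addTo (suc (suc d)) _ (col false (suc n) b c) cs (inj₁ (s≤s ()) ∷ _)
parts-addTo (suc (suc d)) _ (col false (suc n) b c) cs (inj₂ (() , _) ∷ _)
parts-addTo (suc (suc d)) _ (col false 0 true c) cs (inj₁ (s≤s (s≤s ())) ∷ _)
parts-addTo (suc (suc d)) _ (col false 0 true c) cs (inj₂ (() , _) ∷ _)
parts-addTo (suc (suc d)) _ (col false 0 false (suc c)) cs (inj₁ (s≤s (s≤s ())) ∷ _)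
parts-addTo (suc (suc d)) _ (col false 0 false (suc c)) cs (inj₂ (() , _) ∷ _)
parts-addTo (suc (suc d)) β ∅ᶜ cs h = begin
  parts 2 (add (suc d) β cs)             ≡⟨ sym (parts-shift 0 (add (suc d) β cs)) ⟩
  map shift (parts 0 (add (suc d) β cs)) ≡⟨ cong (map shift) (parts-add d β cs below) ⟩
  (3 + d , β) ∷ map shift (parts 0 cs)   ≡⟨ cong (_ ∷_) (parts-shift 0 cs) ⟩
  (3 + d , β) ∷ parts 2 cs               ∎
  where
  open ≡-Reasoning
  unshift : ∀ {q} → (3 + d , β) ⊴ shift q → (suc d , β) ⊴ q
  unshift (inj₁ (s≤s (s≤s l))) = inj₁ l
  unshift (inj₂ (refl , e))    = inj₂ (refl , e)
  below : All ((suc d , β) ⊴_) (parts 0 cs)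
  below = All.map unshift (All.map⁻ (subst (All _) (sym (parts-shift 0 cs)) h))
parts-add d β []       h = parts-addTo d β ∅ᶜ [] h
parts-add d β (x ∷ cs) h = parts-addTo d β x cs h

parts-columns : ∀ ps → All (λ p → 1 ≤ size p) ps → AllPairs _⊴_ ps → parts 0 (columns ps) ≡ ps
parts-columns [] _ _ = refl
parts-columns ((suc d , β) ∷ ps) (_ ∷ pos) (h ∷ ord) =
  trans (parts-add d β (columns ps) (subst (All _) (sym e) h)) (cong (_ ∷_) e)
  where e = parts-columns ps pos ord

add≢[] : ∀ s β cs → add (suc s) β cs ≢ []
add≢[] zero          true  []                  ()
add≢[] zero          true  (col _ _ _ _ ∷ cs)  ()
add≢[] zero          false []                  ()
add≢[] zero          false (col _ _ _ _ ∷ cs)  ()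
add≢[] (suc zero)    true  []                  ()
add≢[] (suc zero)    true  (col _ _ _ _ ∷ cs)  ()
add≢[] (suc zero)    false []                  ()
add≢[] (suc zero)    false (col _ _ _ _ ∷ cs)  ()
add≢[] (suc (suc s)) β     []                  ()
add≢[] (suc (suc s)) β     (col _ _ _ _ ∷ cs)  ()

addTo-canonical : ∀ d β h cs → CanonicalC cs → CanonicalC (addTo (suc d) β h cs)
add-canonical   : ∀ d β cs → CanonicalC cs → CanonicalC (add (suc d) β cs)
addTo-canonical 0 true  (col o n b c) cs k = k , λ _ ()
addTo-canonical 0 false (col o n b c) cs k = k , λ _ ()
addTo-canonical 1 true  (col o n b c) cs k = k , λ _ ()
addTo-canonical 1 false (col o n b c) cs k = k , λ _ ()
addTo-canonical (suc (suc d)) β h cs k = add-canonical d β cs k , λ e → ⊥-elim (add≢[] d β cs e)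
add-canonical d β []       k = addTo-canonical d β ∅ᶜ [] tt
add-canonical d β (h ∷ cs) k = addTo-canonical d β h cs (proj₁ k)

columns-canonical : ∀ ps → All (λ p → 1 ≤ size p) ps → CanonicalC (columns ps)
columns-canonical [] _ = tt
columns-canonical ((suc d , β) ∷ ps) (_ ∷ pos) = add-canonical d β (columns ps) (columns-canonical ps pos)

-- The cons under which canonical lists are closed: `columns` never produces an empty last column,
-- so its values on partly built lists have the form `place h cs`.
place : Col → List Col → List Col
place h@(col true _ _ _)              cs       = h ∷ cs
place h@(col false (suc _) _ _)       cs       = h ∷ cs
place h@(col false zero true _)       cs       = h ∷ cs
place h@(col false zero false (suc _)) cs      = h ∷ cs
place h@(col false zero false zero)   []       = []
place h@(col false zero false zero)   (x ∷ cs) = h ∷ x ∷ cs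

add-place : ∀ s β h cs → add s β (place h cs) ≡ addTo s β h cs
add-place s β (col true _ _ _)               cs       = refl
add-place s β (col false (suc _) _ _)        cs       = refl
add-place s β (col false zero true _)        cs       = refl
add-place s β (col false zero false (suc _)) cs       = refl
add-place s β (col false zero false zero)    []       = refl
add-place s β (col false zero false zero)    (x ∷ cs) = refl

place-canonical : ∀ h cs → CanonicalC (h ∷ cs) → place h cs ≡ h ∷ cs
place-canonical (col true _ _ _)               cs       _ = refl
place-canonical (col false (suc _) _ _)        cs       _ = refl
place-canonical (col false zero true _)        cs       _ = refl
place-canonical (col false zero false (suc _)) cs       _ = refl
place-canonical (col false zero false zero)    (x ∷ cs) _ = refl
place-canonical (col false zero false zero)    []       (_ , ne) = ⊥-elim (ne refl refl)

place-∅ : ∀ {cs} → cs ≢ [] → place ∅ᶜ cs ≡ ∅ᶜ ∷ cs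
place-∅ {[]}    ne = ⊥-elim (ne refl)
place-∅ {_ ∷ _} _  = refl

columns-shift : ∀ ps → All (λ p → 1 ≤ size p) ps → columns (map shift ps) ≡ place ∅ᶜ (columns ps)
columns-shift [] _ = refl
columns-shift ((suc s , β) ∷ ps) (_ ∷ pos) rewrite columns-shift ps pos with columns ps
... | []     = sym (place-∅ (add≢[] s β []))
... | h ∷ cs = sym (place-∅ (add≢[] s β (h ∷ cs)))

columns-c : ∀ c {ps cs} → columns ps ≡ place ∅ᶜ cs →
  columns (replicate c (2 , false) ++ ps) ≡ place (col false 0 false c) cs
columns-c zero    e = e
columns-c (suc c) {ps} {cs} e rewrite columns-c c {ps} {cs} e = add-place 2 false (col false 0 false c) cs

columns-b : ∀ b {c ps cs} → columns ps ≡ place (col false 0 false c) cs →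
  columns (replicate (val b) (2 , true) ++ ps) ≡ place (col false 0 b c) cs
columns-b false e = e
columns-b true {c} {ps} {cs} e rewrite e = add-place 2 true (col false 0 false c) cs

columns-n : ∀ n {b c ps cs} → columns ps ≡ place (col false 0 b c) cs →
  columns (replicate n (1 , false) ++ ps) ≡ place (col false n b c) cs
columns-n zero    e = e
columns-n (suc n) {b} {c} {ps} {cs} e rewrite columns-n n {b} {c} {ps} {cs} e = add-place 1 false (col false n b c) cs

columns-o : ∀ o {n b c ps cs} → columns ps ≡ place (col false n b c) cs →
  columns (replicate (val o) (1 , true) ++ ps) ≡ place (col o n b c) cs
columns-o false e = e
columns-o true {n} {b} {c} {ps} {cs} e rewrite e = add-place 1 true (col false n b c) cs

parts-all : ∀ {P : Part → Set} a → (∀ s β → a < s → P (s , β)) → ∀ cs → All P (parts a cs)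
parts-all a h [] = []
parts-all a h (col o n b c ∷ cs) =
  All.++⁺ (All.replicate⁺ (val o) (h _ _ ≤-refl)) (All.++⁺ (All.replicate⁺ n (h _ _ ≤-refl))
    (All.++⁺ (All.replicate⁺ (val b) (h _ _ (n≤1+n _))) (All.++⁺ (All.replicate⁺ c (h _ _ (n≤1+n _)))
      (parts-all (2 + a) (λ s β l → h s β (≤-trans (s≤s (≤-trans (n≤1+n _) (n≤1+n _))) l)) cs))))

parts-positive : ∀ cs → All (λ p → 1 ≤ size p) (parts 0 cs)
parts-positive = parts-all 0 (λ _ _ l → l)

columns-parts : ∀ cs → CanonicalC cs → columns (parts 0 cs) ≡ cs
columns-parts [] _ = refl
columns-parts (col o n b c ∷ cs) k = trans
  (columns-o o (columns-n n (columns-b b (columns-c c e))))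
  (place-canonical (col o n b c) cs k)
  where
  e : columns (parts 2 cs) ≡ place ∅ᶜ cs
  e = begin
    columns (parts 2 cs)             ≡⟨ cong columns (sym (parts-shift 0 cs)) ⟩
    columns (map shift (parts 0 cs)) ≡⟨ columns-shift (parts 0 cs) (parts-positive cs) ⟩
    place ∅ᶜ (columns (parts 0 cs))  ≡⟨ cong (place ∅ᶜ) (columns-parts cs (proj₁ k)) ⟩
    place ∅ᶜ cs                      ∎
    where open ≡-Reasoning

replicate-pairs : ∀ n p {ys} → p ⊴ p → All (p ⊴_) ys → AllPairs _⊴_ ys → AllPairs _⊴_ (replicate n p ++ ys)
replicate-pairs zero    p _  _ ps = ps
replicate-pairs (suc n) p pp a ps =
  All.++⁺ (All.replicate⁺ n pp) a ∷ replicate-pairs n p pp a ps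

val-pairs : ∀ b p {ys} → All (p ⊴_) ys → AllPairs _⊴_ ys → AllPairs _⊴_ (replicate (val b) p ++ ys)
val-pairs false p _ ps = ps
val-pairs true  p a ps = a ∷ ps

parts-ordered : ∀ a cs → AllPairs _⊴_ (parts a cs)
parts-ordered a [] = []
parts-ordered a (col o n b c ∷ cs) =
  val-pairs o (1 + a , true) (All.++⁺ (All.replicate⁺ n (inj₂ (refl , refl))) (A₂ true))
    (replicate-pairs n (1 + a , false) (inj₂ (refl , refl)) (A₂ false)
      (val-pairs b (2 + a , true) (All.++⁺ (All.replicate⁺ c (inj₂ (refl , refl))) (A (2 + a , true) ≤-refl))
        (replicate-pairs c (2 + a , false) (inj₂ (refl , refl)) (A (2 + a , false) ≤-refl)
          (parts-ordered (2 + a) cs))))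
  where
  A : ∀ p → size p ≤ 2 + a → All (p ⊴_) (parts (2 + a) cs)
  A p l = parts-all (2 + a) (λ s β l′ → inj₁ (≤-<-trans l l′)) cs
  A₂ : ∀ β → All ((1 + a , β) ⊴_) (replicate (val b) (2 + a , true) ++ replicate c (2 + a , false) ++ parts (2 + a) cs)
  A₂ β = All.++⁺ (All.replicate⁺ (val b) (inj₁ ≤-refl)) (All.++⁺ (All.replicate⁺ c (inj₁ ≤-refl)) (A (1 + a , β) (n≤1+n _)))

2*suc∸1 : ∀ s → 2 * suc s ∸ 1 ≡ suc (2 * s)
2*suc∸1 s = +-suc s (s + 0)

key-≥ : ∀ s β → 2 * s ∸ 1 ≤ key (s , β)
key-≥ s true  = ≤-refl
key-≥ s false = m∸n≤m (2 * s) 1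

key-≤ : ∀ s β → key (s , β) ≤ 2 * s
key-≤ s true  = m∸n≤m (2 * s) 1
key-≤ s false = ≤-refl

key-mono-< : ∀ {s t} β γ → s < t → key (s , β) < key (t , γ)
key-mono-< {s} {suc t} β γ (s≤s s≤t) = begin-strict
  key (s , β)   ≤⟨ key-≤ s β ⟩
  2 * s         ≤⟨ *-monoʳ-≤ 2 s≤t ⟩
  2 * t         <⟨ n<1+n _ ⟩
  suc (2 * t)   ≡⟨ sym (2*suc∸1 t) ⟩
  2 * suc t ∸ 1 ≤⟨ key-≥ (suc t) γ ⟩
  key (suc t , γ) ∎
  where open ≤-Reasoning

⊴⇒key≤ : ∀ {p q} → p ⊴ q → key p ≤ key q
⊴⇒key≤ {s , β} {t , γ} (inj₁ l) = <⇒≤ (key-mono-< β γ l)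
⊴⇒key≤ {s , β} {_ , _} (inj₂ (refl , refl)) = key-≤ s β

key≤⇒⊴ : ∀ {p q} → 1 ≤ size p → key p ≤ key q → ¬ (proj₂ p ≡ true × p ≡ q) → p ⊴ q
key≤⇒⊴ {s , β} {t , γ} pos l ne with <-cmp s t
... | tri< s<t _ _ = inj₁ s<t
... | tri> _ _ t<s = ⊥-elim (<⇒≱ (key-mono-< γ β t<s) l)
key≤⇒⊴ {s , β} {t , false} pos l ne | tri≈ _ refl _ = inj₂ (refl , refl)
key≤⇒⊴ {s , true} {t , true} pos l ne | tri≈ _ refl _ = ⊥-elim (ne (refl , refl))
-- Positivity matters here: at size 0 the truncated key does not separate the two parts.
key≤⇒⊴ {suc s , false} {_ , true} pos l ne | tri≈ _ refl _ =
  ⊥-elim (1+n≰n l)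

-- Multiplicities

eqPart-refl : ∀ p → eqPart p p ≡ true
eqPart-refl (zero , true)  = refl
eqPart-refl (zero , false) = refl
eqPart-refl (suc s , β)    = eqPart-refl (s , β)

count-self : ∀ p ps → count p (p ∷ ps) ≡ suc (count p ps)
count-self p ps rewrite eqPart-refl p = refl

count≡0 : ∀ p ps → count p ps ≡ 0 → All (p ≢_) ps
count≡0 p [] _ = []
count≡0 p (q ∷ ps) e with eqPart p q in eq
... | false = (λ { refl → case (trans (sym eq) (eqPart-refl p)) }) ∷ count≡0 p ps e
  where
  case : false ≢ true
  case ()

overpartition-ordered : ∀ ps → IsOverpartition ps → AllPairs _⊴_ ps
overpartition-ordered [] _ = []
overpartition-ordered (p ∷ ps) (pos ∷ poss , sorted , unique) =
  All.zipWith (λ (l , ne) → key≤⇒⊴ pos l ne) (keys , distinct p unique)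
  ∷ overpartition-ordered ps (poss , Linked.tail sorted , λ s → ≤-trans (m≤n+m _ _) (unique s))
  where
  keys : All (λ q → key p ≤ key q) ps
  keys = AllPairs.head (Linked.Linked⇒AllPairs {R = λ p q → key p ≤ key q} ≤-trans sorted)
  distinct : ∀ p → (∀ s → f̄ s (p ∷ ps) ≤ 1) → All (λ q → ¬ (proj₂ p ≡ true × p ≡ q)) ps
  distinct (s , false) u = All.universal (λ _ ()) ps
  distinct (s , true)  u = All.map (λ ne (_ , e) → ne e)
    (count≡0 (s , true) ps (n≤0⇒n≡0 (s≤s⁻¹ (subst (_≤ 1) (count-self (s , true) ps) (u s)))))

count-replicate : ∀ p q n {ys v} → count p ys ≡ v →
  count p (replicate n q ++ ys) ≡ (if eqPart p q then n else 0) + v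
count-replicate p q zero e with eqPart p q
... | true  = e
... | false = e
count-replicate p q (suc n) e with eqPart p q | count-replicate p q n e
... | true  | h = cong suc h
... | false | h = h

count-col : ∀ p a o n b c cs {v} → count p (parts (2 + a) cs) ≡ v → count p (parts a (col o n b c ∷ cs)) ≡
  (if eqPart p (1 + a , true) then val o else 0) + ((if eqPart p (1 + a , false) then n else 0) +
  ((if eqPart p (2 + a , true) then val b else 0) + ((if eqPart p (2 + a , false) then c else 0) + v)))
count-col p a o n b c cs e = count-replicate p (1 + a , true) (val o) (count-replicate p (1 + a , false) n
  (count-replicate p (2 + a , true) (val b) (count-replicate p (2 + a , false) c e)))

≡ᵇ-< : ∀ {m n} → m < n → (m ≡ᵇ n) ≡ false
≡ᵇ-< {zero}  {suc n} _ = refl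
≡ᵇ-< {suc m} {suc n} (s≤s l) = ≡ᵇ-< l

count-low : ∀ {s a} β cs → s ≤ a → count (s , β) (parts a cs) ≡ 0
count-low β [] _ = refl
count-low {s} {a} β (col o n b c ∷ cs) l
  rewrite count-col (s , β) a o n b c cs (count-low β cs (≤-trans l (≤-trans (n≤1+n a) (n≤1+n (suc a)))))
        | ≡ᵇ-< (s≤s l) | ≡ᵇ-< (s≤s (≤-trans l (n≤1+n a))) = refl

count-shift : ∀ s β a cs → count (2 + s , β) (parts (2 + a) cs) ≡ count (s , β) (parts a cs)
count-shift s β a [] = refl
count-shift s β a (col o n b c ∷ cs) =
  trans (count-col (2 + s , β) (2 + a) o n b c cs (count-shift s β (2 + a) cs))
    (sym (count-col (s , β) a o n b c cs refl))

count-tail : ∀ s β h cs → count (3 + s , β) (parts 0 (h ∷ cs)) ≡ count (1 + s , β) (parts 0 cs)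
count-tail s β (col o n b c) cs = count-col (3 + s , β) 0 o n b c cs (count-shift (1 + s) β 0 cs)

f̄₁ : ∀ o n b c cs → f̄ 1 (parts 0 (col o n b c ∷ cs)) ≡ val o
f̄₁ o n b c cs = trans (count-col (1 , true) 0 o n b c cs (count-low true cs (s≤s z≤n))) (+-identityʳ _)

f₁ : ∀ o n b c cs → f 1 (parts 0 (col o n b c ∷ cs)) ≡ n
f₁ o n b c cs = trans (count-col (1 , false) 0 o n b c cs (count-low false cs (s≤s z≤n))) (+-identityʳ _)

f̄₂ : ∀ o n b c cs → f̄ 2 (parts 0 (col o n b c ∷ cs)) ≡ val b
f̄₂ o n b c cs = trans (count-col (2 , true) 0 o n b c cs (count-low true cs ≤-refl)) (+-identityʳ _)

f₂ : ∀ o n b c cs → f 2 (parts 0 (col o n b c ∷ cs)) ≡ c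
f₂ o n b c cs = trans (count-col (2 , false) 0 o n b c cs (count-low false cs ≤-refl)) (+-identityʳ _)

val≤1 : ∀ b → val b ≤ 1
val≤1 false = z≤n
val≤1 true  = ≤-refl

parts-unique : ∀ s cs → f̄ s (parts 0 cs) ≤ 1
parts-unique s [] = z≤n
parts-unique 0 cs = ≤-trans (≤-reflexive (count-low true cs z≤n)) z≤n
parts-unique 1 (col o n b c ∷ cs) rewrite f̄₁ o n b c cs = val≤1 o
parts-unique 2 (col o n b c ∷ cs) rewrite f̄₂ o n b c cs = val≤1 b
parts-unique (suc (suc (suc s))) (h ∷ cs) rewrite count-tail s true h cs = parts-unique (suc s) cs

parts-overpartition : ∀ cs → IsOverpartition (parts 0 cs)
parts-overpartition cs =
  parts-positive cs , Linked.AllPairs⇒Linked (AllPairs.map (λ {p} {q} → ⊴⇒key≤ {p} {q}) (parts-ordered 0 cs)) , λ s → parts-unique s cs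

-- Marks as a greedy selection

true≢false : true ≢ false
true≢false ()

-- The number of elements of {1, …, r} missing from Y.
free : ℕ → List ℕ → ℕ
free zero    Y = 0
free (suc r) Y = (if elemℕ (suc r) Y then 0 else 1) + free r Y

-- 1 if 1 ≤ m ≤ r and 0 otherwise.
ind : ℕ → ℕ → ℕ
ind zero    m = 0
ind (suc r) m = (if suc r ≡ᵇ m then 1 else 0) + ind r m

markedUpTo : ℕ → List ℕ → ℕ
markedUpTo zero    L = 0
markedUpTo (suc r) L = countℕ (suc r) L + markedUpTo r L

markedUpTo-∷ : ∀ r m L → markedUpTo r (m ∷ L) ≡ ind r m + markedUpTo r L
markedUpTo-∷ zero    m L = refl
markedUpTo-∷ (suc r) m L rewrite markedUpTo-∷ r m L =
  +-interchange (if suc r ≡ᵇ m then 1 else 0) (countℕ (suc r) L) (ind r m) (markedUpTo r L)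
  where
  +-interchange : ∀ a b c d → (a + b) + (c + d) ≡ (a + c) + (b + d)
  +-interchange a b c d rewrite +-assoc a b (c + d) | sym (+-assoc b c d) | +-comm b c
    | +-assoc c b d | +-assoc a c (b + d) = refl

≡ᵇ-refl : ∀ n → (n ≡ᵇ n) ≡ true
≡ᵇ-refl zero    = refl
≡ᵇ-refl (suc n) = ≡ᵇ-refl n

≡ᵇ-true : ∀ m n → (m ≡ᵇ n) ≡ true → m ≡ n
≡ᵇ-true m n e = ≡ᵇ⇒≡ m n (Equivalence.from T-≡ e)

≡ᵇ-≢ : ∀ {m n} → m ≢ n → (m ≡ᵇ n) ≡ false
≡ᵇ-≢ {m} {n} ne with m ≡ᵇ n in e
... | false = refl
... | true  = ⊥-elim (ne (≡ᵇ-true m n e))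

elem-here : ∀ m Y → elemℕ m (m ∷ Y) ≡ true
elem-here m Y rewrite ≡ᵇ-refl m = refl

elem-there : ∀ {j} m Y → elemℕ j Y ≡ true → elemℕ j (m ∷ Y) ≡ true
elem-there {j} m Y e rewrite e = ∨-zeroʳ (j ≡ᵇ m)

elem-∷⁻ : ∀ {j} m Y → elemℕ j (m ∷ Y) ≡ true → j ≡ m ⊎ elemℕ j Y ≡ true
elem-∷⁻ {j} m Y e with j ≡ᵇ m in eq
... | true  = inj₁ (≡ᵇ-true j m eq)
... | false = inj₂ e

ind-< : ∀ {r m} → r < m → ind r m ≡ 0
ind-< {zero}  _ = refl
ind-< {suc r} l rewrite ≡ᵇ-< l = ind-< (<-trans (n<1+n r) l)

ind-≥ : ∀ {r m} → 1 ≤ m → m ≤ r → ind r m ≡ 1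
ind-≥ {zero}  {suc m} _ ()
ind-≥ {suc r} {m} p l with m≤n⇒m<n∨m≡n l
... | inj₁ m<r rewrite ≡ᵇ-≢ (λ e → <-irrefl (sym e) m<r) = ind-≥ p (s≤s⁻¹ m<r)
... | inj₂ refl rewrite ≡ᵇ-refl r | ind-< (n<1+n r) = refl

ind-0 : ∀ r → ind r 0 ≡ 0
ind-0 zero    = refl
ind-0 (suc r) = ind-0 r

ind≤1 : ∀ r m → ind r m ≤ 1
ind≤1 r zero rewrite ind-0 r = z≤n
ind≤1 r (suc m) with suc m ≤? r
... | yes l = ≤-reflexive (ind-≥ (s≤s z≤n) l)
... | no  l = ≤-trans (≤-reflexive (ind-< (≰⇒> l))) z≤n

free-cong : ∀ r {Y Z} → (∀ j → elemℕ j Y ≡ elemℕ j Z) → free r Y ≡ free r Z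
free-cong zero    e = refl
free-cong (suc r) e rewrite e (suc r) = cong (_ +_) (free-cong r e)

+-swap : ∀ a b c → a + (b + c) ≡ b + (a + c)
+-swap a b c rewrite sym (+-assoc a b c) | +-comm a b = +-assoc b a c

free-∷ : ∀ r m Y → elemℕ m Y ≡ false → free r Y ≡ ind r m + free r (m ∷ Y)
free-∷ zero    m Y fr = refl
free-∷ (suc r) m Y fr with suc r ≡ᵇ m in eq
... | true  rewrite ≡ᵇ-true (suc r) m eq | fr = cong suc (free-∷ r m Y fr)
... | false = trans (cong (x +_) (free-∷ r m Y fr)) (+-swap x (ind r m) _)
  where x = if elemℕ (suc r) Y then 0 else 1

free-[] : ∀ r → free r [] ≡ r
free-[] zero    = refl
free-[] (suc r) = cong suc (free-[] r)

free-≤ : ∀ r Y → free r Y ≤ r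
free-≤ zero    Y = z≤n
free-≤ (suc r) Y with elemℕ (suc r) Y
... | true  = m≤n⇒m≤1+n (free-≤ r Y)
... | false = s≤s (free-≤ r Y)

free-absorb : ∀ r m Y → elemℕ m Y ≡ true → free r (m ∷ Y) ≡ free r Y
free-absorb r m Y e = free-cong r λ j → lemma j
  where
  lemma : ∀ j → elemℕ j (m ∷ Y) ≡ elemℕ j Y
  lemma j with j ≡ᵇ m in eq
  ... | false = refl
  ... | true rewrite ≡ᵇ-true j m eq = sym e

free-∷-≤ : ∀ r m Y → free r Y ≤ suc (free r (m ∷ Y))
free-∷-≤ r m Y with elemℕ m Y in e
... | true  = ≤-trans (≤-reflexive (sym (free-absorb r m Y e))) (n≤1+n _)
... | false = ≤-trans (≤-reflexive (free-∷ r m Y e)) (+-monoˡ-≤ _ (ind≤1 r m))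

-- Justifies the fuel of `mex`: one of the values from 1 to `suc (length Y)` is missing from `Y`.
pigeonhole : ∀ r Y → r ≤ free r Y + length Y
pigeonhole r []      = ≤-reflexive (sym (trans (+-identityʳ _) (free-[] r)))
pigeonhole r (m ∷ Y) = ≤-trans (pigeonhole r Y)
  (≤-trans (+-monoˡ-≤ (length Y) (free-∷-≤ r m Y)) (≤-reflexive (sym (+-suc _ _))))

record IsMex (m : ℕ) (Y : List ℕ) : Set where
  constructor isMex
  field
    pos   : 1 ≤ m
    fresh : elemℕ m Y ≡ false
    below : ∀ j → 1 ≤ j → j < m → elemℕ j Y ≡ true

free-full : ∀ r Y → (∀ j → 1 ≤ j → j ≤ r → elemℕ j Y ≡ true) → free r Y ≡ 0
free-full zero    Y h = refl
free-full (suc r) Y h rewrite h (suc r) (s≤s z≤n) ≤-refl =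
  free-full r Y (λ j p l → h j p (m≤n⇒m≤1+n l))

free-empty : ∀ r Y → (∀ j → 1 ≤ j → j ≤ r → elemℕ j Y ≡ false) → free r Y ≡ r
free-empty zero    Y h = refl
free-empty (suc r) Y h rewrite h (suc r) (s≤s z≤n) ≤-refl =
  cong suc (free-empty r Y (λ j p l → h j p (m≤n⇒m≤1+n l)))

mexGo-correct : ∀ k n Y → 1 ≤ n → n + k ≡ suc (length Y) →
  (∀ j → 1 ≤ j → j < n → elemℕ j Y ≡ true) → IsMex (mexGo k n Y) Y
mexGo-correct zero n Y p e h with elemℕ n Y in eq
... | false = isMex p eq h
... | true  = ⊥-elim (1+n≰n (≤-trans (≤-reflexive (sym n≡)) (subst (λ z → n ≤ z + length Y) full (pigeonhole n Y))))
  where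
  n≡ : n ≡ suc (length Y)
  n≡ = trans (sym (+-identityʳ n)) e
  full : free n Y ≡ 0
  full = free-full n Y λ j p′ l → case j p′ (m≤n⇒m<n∨m≡n l)
    where
    case : ∀ j → 1 ≤ j → j < n ⊎ j ≡ n → elemℕ j Y ≡ true
    case j p′ (inj₁ l)    = h j p′ l
    case j p′ (inj₂ refl) = eq
mexGo-correct (suc k) n Y p e h with elemℕ n Y in eq
... | false = isMex p eq h
... | true  = mexGo-correct k (suc n) Y (s≤s z≤n) (trans (sym (+-suc n k)) e) λ j p′ l → case j p′ (m≤n⇒m<n∨m≡n (s≤s⁻¹ l))
  where
  case : ∀ j → 1 ≤ j → j < n ⊎ j ≡ n → elemℕ j Y ≡ true
  case j p′ (inj₁ l)    = h j p′ l
  case j p′ (inj₂ refl) = eq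

mex-correct : ∀ Y → IsMex (mex Y) Y
mex-correct Y = mexGo-correct (length Y) 1 Y ≤-refl refl λ { (suc j) _ (s≤s ()) }

-- A mex stays within `r` as long as some value up to `r` is missing. This turns marking into a
-- selection with room `free r Y`.
ind-mex : ∀ r {m Y} → IsMex m Y → ind r m ≡ 1 ⊓ free r Y
ind-mex r {m} {Y} (isMex p fr bl) with m ≤? r
... | no m≰r rewrite free-full r Y (λ j p′ l → bl j p′ (≤-<-trans l (≰⇒> m≰r))) = ind-< (≰⇒> m≰r)
... | yes m≤r rewrite free-∷ r m Y fr | ind-≥ p m≤r = refl

free-mex : ∀ r {m Y} → IsMex m Y → free r (m ∷ Y) ≡ free r Y ∸ 1
free-mex r {m} {Y} M =
  lemma (free r Y) (trans (free-∷ r m Y (IsMex.fresh M)) (cong (_+ free r (m ∷ Y)) (ind-mex r M)))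
  where
  lemma : ∀ a {b} → a ≡ (1 ⊓ a) + b → b ≡ a ∸ 1
  lemma zero    e = sym e
  lemma (suc a) e = sym (suc-injective e)

-- The marks met by a new part

marksWhere-cong : ∀ {P Q : ℕ → Bool} L → All (λ q → P (size (proj₁ q)) ≡ Q (size (proj₁ q))) L →
  marksWhere P L ≡ marksWhere Q L
marksWhere-cong [] _ = refl
marksWhere-cong {P} {Q} ((q , m) ∷ L) (e ∷ es) rewrite e | marksWhere-cong {P} {Q} L es = refl

marksWhere-none : ∀ {P : ℕ → Bool} L → All (λ q → P (size (proj₁ q)) ≡ false) L → marksWhere P L ≡ []
marksWhere-none [] _ = refl
marksWhere-none ((q , m) ∷ L) (e ∷ es) rewrite e = marksWhere-none L es

inWindow : ℕ → ℕ → Bool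
inWindow s u = (u ≤ᵇ s) ∧ (s ≤ᵇ u + 2)

≤ᵇ-true : ∀ {m n} → m ≤ n → (m ≤ᵇ n) ≡ true
≤ᵇ-true l = Equivalence.to T-≡ (≤⇒≤ᵇ l)

≤ᵇ-false : ∀ {m n} → n < m → (m ≤ᵇ n) ≡ false
≤ᵇ-false {m} {n} l with m ≤ᵇ n in e
... | false = refl
... | true  = ⊥-elim (<⇒≱ l (≤ᵇ⇒≤ m n (Equivalence.from T-≡ e)))

window-old : ∀ a u → u ≤ a → inWindow (2 + a) u ≡ (u ≡ᵇ a)
window-old a u l rewrite ≤ᵇ-true (≤-trans l (≤-trans (n≤1+n a) (n≤1+n (suc a)))) | +-comm u 2
  with m≤n⇒m<n∨m≡n l
... | inj₁ u<a rewrite ≡ᵇ-< u<a = ≤ᵇ-false (s≤s (s≤s u<a))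
... | inj₂ refl rewrite ≡ᵇ-refl u = ≤ᵇ-true {2 + u} ≤-refl

window-new : ∀ a u → a ≤ u → u ≤ 2 + a → inWindow (2 + a) u ≡ true
window-new a u l l′ rewrite ≤ᵇ-true l′ | +-comm u 2 = ≤ᵇ-true (s≤s (s≤s l))

occurs-count : ∀ p xs → occurs p xs ≡ (0 <ᵇ count p xs)
occurs-count p [] = refl
occurs-count p (q ∷ xs) with eqPart p q
... | true  = refl
... | false = occurs-count p xs

minPos-zero : ∀ X → All (1 ≤_) X → minPos X ≡ 0 → X ≡ []
minPos-zero [] _ _ = refl
minPos-zero (suc x ∷ X) (_ ∷ ps) e with minPos X
minPos-zero (suc x ∷ X) (_ ∷ ps) () | zero
minPos-zero (suc x ∷ X) (_ ∷ ps) () | suc m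

minPos-least : ∀ X g → All (1 ≤_) X → minPos X ≡ suc g →
  elemℕ (suc g) X ≡ true × (∀ j → elemℕ j X ≡ true → suc g ≤ j)
minPos-least (suc x ∷ X) g (_ ∷ ps) e with minPos X in eq
minPos-least (suc x ∷ X) .x (_ ∷ ps) refl | zero rewrite minPos-zero X ps eq =
  elem-here (suc x) [] , λ j h → case j (elem-∷⁻ (suc x) [] h)
  where
  case : ∀ j → j ≡ suc x ⊎ false ≡ true → suc x ≤ j
  case j (inj₁ refl) = ≤-refl
minPos-least (suc x ∷ X) g (_ ∷ ps) e | suc m with minPos-least X m ps eq
... | inX , least with suc-injective e
... | refl = here , λ j h → case j (elem-∷⁻ (suc x) X h)
  where
  case : ∀ j → j ≡ suc x ⊎ elemℕ j X ≡ true → suc (x ⊓ m) ≤ j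
  case j (inj₁ refl) = s≤s (m⊓n≤m x m)
  case j (inj₂ h)    = ≤-trans (s≤s (m⊓n≤n x m)) (least j h)
  here : elemℕ (suc (x ⊓ m)) (suc x ∷ X) ≡ true
  here with ⊓-sel x m
  ... | inj₁ e′ rewrite e′ = elem-here (suc x) X
  ... | inj₂ e′ rewrite e′ = elem-there (suc x) X inX

Marked : Set
Marked = List (Part × ℕ)

isEven-suc : ∀ a → isEven a ≡ true → isEven (suc a) ≡ false
isEven-suc zero          _ = refl
isEven-suc (suc (suc a)) e = isEven-suc a e

ones : ℕ → List ℕ → List ℕ
ones zero    Y = Y
ones (suc n) Y = ones n (1 ∷ Y)

pushOnes : ℕ → Part → Marked → Marked
pushOnes zero    p prior = prior
pushOnes (suc n) p prior = pushOnes n p ((p , 1) ∷ prior)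

lastMark : ℕ → ℕ → ℕ
lastMark zero    prev = prev
lastMark (suc _) _    = 1

lastMark-1 : ∀ n → lastMark n 1 ≡ 1
lastMark-1 zero    = refl
lastMark-1 (suc n) = refl

All-ones : ∀ n {Y} → All (1 ≤_) Y → All (1 ≤_) (ones n Y)
All-ones zero    h = h
All-ones (suc n) h = All-ones n (s≤s z≤n ∷ h)

elem-ones : ∀ n j Y → elemℕ j Y ≡ true → elemℕ j (ones n Y) ≡ true
elem-ones zero    j Y h = h
elem-ones (suc n) j Y h = elem-ones n j (1 ∷ Y) (elem-there {j} 1 Y h)

elem-ones-suc : ∀ n j Y → elemℕ j (ones (suc n) Y) ≡ elemℕ j (1 ∷ Y)
elem-ones-suc zero    j Y = refl
elem-ones-suc (suc n) j Y rewrite elem-ones-suc n j (1 ∷ Y) with j ≡ᵇ 1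
... | true  = refl
... | false = refl

free-ones : ∀ r n {Y} → elemℕ 1 Y ≡ true → free r (ones n Y) ≡ free r Y
free-ones r zero    h = refl
free-ones r (suc n) {Y} h = trans (free-cong r (λ j → elem-ones-suc n j Y)) (free-absorb r 1 Y h)

marksGo-ones : ∀ lam r′ p → (∀ prior prev → markOf lam prior prev p ≡ 1) → ∀ n prior prev rest →
  markedUpTo (suc r′) (marksGo lam prior prev (replicate n p ++ rest))
  ≡ n + markedUpTo (suc r′) (marksGo lam (pushOnes n p prior) (lastMark n prev) rest)
marksGo-ones lam r′ p h zero    prior prev rest = refl
marksGo-ones lam r′ p h (suc n) prior prev rest rewrite h prior prev =
  trans (markedUpTo-∷ (suc r′) 1 _) (cong₂ _+_ (ind-≥ {suc r′} ≤-refl (s≤s z≤n))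
    (trans (marksGo-ones lam r′ p h n ((p , 1) ∷ prior) 1 rest)
      (cong (λ z → n + markedUpTo (suc r′) (marksGo lam (pushOnes n p ((p , 1) ∷ prior)) z rest)) (lastMark-1 n))))

markOf-odd : ∀ lam prior prev {s} → isEven s ≡ false → markOf lam prior prev (s , false) ≡ 1
markOf-odd lam prior prev e rewrite e = refl

markOf-bar-even : ∀ lam prior prev {s} → isEven s ≡ true → markOf lam prior prev (s , true) ≡ 1
markOf-bar-even lam prior prev e rewrite e = refl

markOf-bar-odd : ∀ lam prior prev {s} → isEven s ≡ false →
  markOf lam prior prev (s , true) ≡ mex (marksWhere (λ u → (u + 1) ≡ᵇ s) prior)
markOf-bar-odd lam prior prev e rewrite e = refl

markOf-even : ∀ lam prior prev {s} → isEven s ≡ true → ∀ {g} →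
  minPos (marksWhere (λ u → (u + 2) ≡ᵇ s) prior) ≡ g →
  markOf lam prior prev (s , false) ≡
  (if (2 ≤ᵇ g) ∧ ((prev + 1) ≡ᵇ g)
       ∧ (occurs (s ∸ 1 , false) lam ∨ occurs (s , true) lam) ∧ not (occurs (s ∸ 1 , true) lam)
   then g else mex (marksWhere (inWindow s) prior))
markOf-even lam prior prev e refl rewrite e = refl

-- X lists the marks of the parts of size a, W those met by a new part of size a + 2,
-- and Z those of size a + 2.
record Window (a : ℕ) (X : List ℕ) (prior : Marked) (W Z : List ℕ) : Set where
  constructor window
  field
    meets : marksWhere (inWindow (2 + a)) prior ≡ W
    top   : marksWhere (_≡ᵇ (2 + a)) prior ≡ Z
    lower : marksWhere (λ u → (u + 2) ≡ᵇ (2 + a)) prior ≡ X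
    sizes : All (λ q → size (proj₁ q) ≤ 2 + a) prior

+2-≡ᵇ : ∀ u a → (u + 2 ≡ᵇ 2 + a) ≡ (u ≡ᵇ a)
+2-≡ᵇ u a rewrite +-comm u 2 = refl

+1-≡ᵇ : ∀ u a → (u + 1 ≡ᵇ 1 + a) ≡ (u ≡ᵇ a)
+1-≡ᵇ u a rewrite +-comm u 1 = refl

window-start : ∀ a prior → All (λ q → size (proj₁ q) ≤ a) prior →
  Window a (marksWhere (_≡ᵇ a) prior) prior (marksWhere (_≡ᵇ a) prior) []
window-start a prior l = window
  (marksWhere-cong prior (All.map (λ {q} → window-old a (size (proj₁ q))) l))
  (marksWhere-none prior (All.map (λ h → ≡ᵇ-< (s≤s (m≤n⇒m≤1+n h))) l))
  (marksWhere-cong prior (All.universal (λ q → +2-≡ᵇ (size (proj₁ q)) a) prior))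
  (All.map (λ h → m≤n⇒m≤1+n (m≤n⇒m≤1+n h)) l)

marksWhere-hit : ∀ (P : ℕ → Bool) q m L {M} → P (size q) ≡ true →
  marksWhere P L ≡ M → marksWhere P ((q , m) ∷ L) ≡ m ∷ M
marksWhere-hit P q m L e refl rewrite e = refl

marksWhere-miss : ∀ (P : ℕ → Bool) q m L {M} → P (size q) ≡ false →
  marksWhere P L ≡ M → marksWhere P ((q , m) ∷ L) ≡ M
marksWhere-miss P q m L e refl rewrite e = refl

window-odd : ∀ {a X prior W Z} β m → Window a X prior W Z →
  Window a X (((1 + a , β) , m) ∷ prior) (m ∷ W) Z
window-odd {a} {prior = prior} β m (window w t l s) = window
  (marksWhere-hit (inWindow (2 + a)) (1 + a , β) m prior (window-new a (1 + a) (n≤1+n a) (n≤1+n _)) w)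
  (marksWhere-miss (_≡ᵇ (2 + a)) (1 + a , β) m prior (≡ᵇ-< (n<1+n (1 + a))) t)
  (marksWhere-miss (λ u → (u + 2) ≡ᵇ (2 + a)) (1 + a , β) m prior (trans (+2-≡ᵇ (1 + a) a) (≡ᵇ-≢ {1 + a} {a} 1+n≢n)) l)
  (n≤1+n _ ∷ s)

window-even : ∀ {a X prior W Z} β m → Window a X prior W Z →
  Window a X (((2 + a , β) , m) ∷ prior) (m ∷ W) (m ∷ Z)
window-even {a} {prior = prior} β m (window w t l s) = window
  (marksWhere-hit (inWindow (2 + a)) (2 + a , β) m prior (window-new a (2 + a) (≤-trans (n≤1+n a) (n≤1+n _)) ≤-refl) w)
  (marksWhere-hit (_≡ᵇ (2 + a)) (2 + a , β) m prior (≡ᵇ-refl a) t)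
  (marksWhere-miss (λ u → (u + 2) ≡ᵇ (2 + a)) (2 + a , β) m prior
    (trans (+2-≡ᵇ (2 + a) a) (≡ᵇ-≢ {2 + a} {a} (λ e → <⇒≢ (≤-trans (n<1+n a) (n≤1+n (suc a))) (sym e)))) l)
  (≤-refl ∷ s)

window-odds : ∀ n {a X prior W Z} β → Window a X prior W Z →
  Window a X (pushOnes n (1 + a , β) prior) (ones n W) Z
window-odds zero    β w = w
window-odds (suc n) β w = window-odds n β (window-odd β 1 w)

window-evens : ∀ n {a X prior W Z} β → Window a X prior W Z →
  Window a X (pushOnes n (2 + a , β) prior) (ones n W) (ones n Z)
window-evens zero    β w = w
window-evens (suc n) β w = window-evens n β (window-even β 1 w)

_⊑_ : List ℕ → List ℕ → Set
Y ⊑ Z = ∀ j → elemℕ j Y ≡ true → elemℕ j Z ≡ true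

⊑-∷ : ∀ m {Y Z} → Y ⊑ Z → (m ∷ Y) ⊑ (m ∷ Z)
⊑-∷ m {Y} {Z} s j h with elem-∷⁻ m Y h
... | inj₁ refl = elem-here m Z
... | inj₂ h′   = elem-there m Z (s j h′)

⊑-false : ∀ {Y Z j} → Y ⊑ Z → elemℕ j Z ≡ false → elemℕ j Y ≡ false
⊑-false {Y} {j = j} s h with elemℕ j Y in e
... | false = refl
... | true  = ⊥-elim (true≢false (trans (sym (s j e)) h))

⊓-unfold : ∀ c φ → suc c ⊓ φ ≡ (1 ⊓ φ) + (c ⊓ (φ ∸ 1))
⊓-unfold c zero    = sym (⊓-zeroʳ c)
⊓-unfold c (suc φ) = refl

-- Summary of the run of plain even parts in a column: `φ` bounds how many get a mark at most `r`,
-- and `frees` says how many marks remain as room for the next column.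
record Evens (lam : List Part) (r a : ℕ) (X : List ℕ) (prior : Marked) (prev : ℕ) (Z : List ℕ)
  (φ c : ℕ) (rest : List Part) : Set where
  constructor evens
  field
    prior′ : Marked
    prev′  : ℕ
    W′ Z′  : List ℕ
    win    : Window a X prior′ W′ Z′
    counts : markedUpTo r (marksGo lam prior prev (replicate c (2 + a , false) ++ rest))
             ≡ (c ⊓ φ) + markedUpTo r (marksGo lam prior′ prev′ rest)
    frees  : free r Z ≡ (c ⊓ φ) + free r Z′
    pos    : All (1 ≤_) Z → All (1 ≤_) Z′

MexStep : List Part → ℕ → List ℕ → (ℕ → List ℕ → List ℕ → Set) → Set
MexStep lam a X Inv = ∀ {prior W Z prev S} → Window a X prior W Z → Inv prev W S →
  let m = markOf lam prior prev (2 + a , false) in IsMex m S × Inv m (m ∷ W) (m ∷ S)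

-- The non-overlined even parts of a column are marked by successive mexes over a list S,
-- which need not be the list W of the marks they meet.
module MexChain (lam : List Part) (r a : ℕ) (X : List ℕ)
  (Inv : ℕ → List ℕ → List ℕ → Set)
  (step : MexStep lam a X Inv) where

  chain : ∀ c {prior prev W Z S} rest → Window a X prior W Z → Inv prev W S → Z ⊑ S →
    Evens lam r a X prior prev Z (free r S) c rest
  chain zero    {prior} {prev} {W} {Z} rest w i s = evens prior prev W Z w refl refl (λ h → h)
  chain (suc c) {prior} {prev} {W} {Z} {S} rest w i s =
    evens prior′ prev′ W′ Z′ win counts′ frees′ (λ h → pos (IsMex.pos M ∷ h))
    where
    m = markOf lam prior prev (2 + a , false)
    M = proj₁ (step w i)
    open Evens (chain c rest (window-even false m w) (proj₂ (step w i)) (⊑-∷ m {Z} {S} s))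
    open ≡-Reasoning
    unfold : ∀ v → ind r m + ((c ⊓ free r (m ∷ S)) + v) ≡ (suc c ⊓ free r S) + v
    unfold v = begin
      ind r m + ((c ⊓ free r (m ∷ S)) + v)
        ≡⟨ sym (+-assoc (ind r m) _ v) ⟩
      ind r m + (c ⊓ free r (m ∷ S)) + v
        ≡⟨ cong₂ (λ x y → x + (c ⊓ y) + v) (ind-mex r M) (free-mex r M) ⟩
      (1 ⊓ free r S) + (c ⊓ (free r S ∸ 1)) + v
        ≡⟨ cong (_+ v) (sym (⊓-unfold c (free r S))) ⟩
      (suc c ⊓ free r S) + v ∎
    counts′ : markedUpTo r (marksGo lam prior prev (replicate (suc c) (2 + a , false) ++ rest))
              ≡ (suc c ⊓ free r S) + markedUpTo r (marksGo lam prior′ prev′ rest)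
    counts′ = trans (markedUpTo-∷ r m _) (trans (cong (ind r m +_) counts) (unfold _))
    frees′ : free r Z ≡ (suc c ⊓ free r S) + free r Z′
    -- A mark fresh for `S` is fresh for `Z` too, so it uses up a place in the room of the next
    -- column.
    frees′ = trans (free-∷ r m Z (⊑-false {Z} {S} s (IsMex.fresh M)))
      (trans (cong (ind r m +_) frees) (unfold _))

-- The exception in rule (d)

exceptional : List Part → ℕ → ℕ → ℕ → Bool
exceptional lam a g prev = (2 ≤ᵇ g) ∧ ((prev + 1) ≡ᵇ g)
  ∧ (occurs (1 + a , false) lam ∨ occurs (2 + a , true) lam) ∧ not (occurs (1 + a , true) lam)

module _ (lam : List Part) (r a : ℕ) (ev : isEven a ≡ true) (X : List ℕ) where

  markOf-window : ∀ {prior W Z} prev → Window a X prior W Z →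
    markOf lam prior prev (2 + a , false) ≡ (if exceptional lam a (minPos X) prev then minPos X else mex W)
  markOf-window {prior} prev (window refl _ l _) = markOf-even lam prior prev ev (cong minPos l)

  evens-regular : ∀ {prior prev W Z} c rest → Window a X prior W Z → Z ⊑ W →
    (∀ prev → exceptional lam a (minPos X) prev ≡ false) →
    Evens lam r a X prior prev Z (free r W) c rest
  evens-regular c rest w s off = MexChain.chain lam r a X (λ _ W S → S ≡ W)
    (λ {_} {_} {_} {prev} → step {prev = prev}) c rest w refl s
    where
    step : ∀ {prior W Z prev S} → Window a X prior W Z → S ≡ W →
      let m = markOf lam prior prev (2 + a , false) in IsMex m S × (m ∷ S) ≡ (m ∷ W)
    step {W = W} {prev = prev} w refl rewrite markOf-window prev w | off prev = mex-correct W , refl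

  module Exceptional (g₂ : ℕ) (min : minPos X ≡ suc (suc g₂))
    (on : ∀ prev → exceptional lam a (minPos X) prev ≡ (prev + 1 ≡ᵇ suc (suc g₂))) where
    private g = suc (suc g₂)

    record Inv (prev : ℕ) (W S : List ℕ) : Set where
      constructor inv
      field
        agree : ∀ j → j ≢ g → elemℕ j S ≡ elemℕ j W
        g∈W   : elemℕ g W ≡ true
        full  : ∀ j → 1 ≤ j → j ≤ prev → elemℕ j S ≡ true
        gap   : ∀ j → elemℕ j S ≡ true → j ≤ prev ⊎ g < j

    mark : ℕ → List ℕ → ℕ
    mark prev W = if prev + 1 ≡ᵇ g then g else mex W

    mark-isMex : ∀ {prev W S} → Inv prev W S → IsMex (mark prev W) S
    mark-isMex {prev} {W} {S} (inv agree g∈W full gap) with prev + 1 ≡ᵇ g in eq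
    ... | true = isMex (s≤s z≤n) fresh (λ j p l → full j p (s≤s⁻¹ (subst (j <_) (sym 1+prev≡g) l)))
      where
      1+prev≡g : suc prev ≡ g
      1+prev≡g = trans (+-comm 1 prev) (≡ᵇ-true (prev + 1) g eq)
      fresh : elemℕ g S ≡ false
      fresh with elemℕ g S in e
      ... | false = refl
      ... | true with gap g e
      ...   | inj₁ l = ⊥-elim (1+n≰n (≤-trans (≤-reflexive 1+prev≡g) l))
      ...   | inj₂ l = ⊥-elim (<-irrefl refl l)
    ... | false = isMex (IsMex.pos M) fresh below
      where
      M = mex-correct W
      m≢g : mex W ≢ g
      m≢g e = true≢false (trans (sym (subst (λ z → elemℕ z W ≡ true) (sym e) g∈W)) (IsMex.fresh M))
      fresh : elemℕ (mex W) S ≡ false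
      fresh = trans (agree _ m≢g) (IsMex.fresh M)
      prev≢ : suc prev ≢ g
      prev≢ e = true≢false (trans (sym (≡ᵇ-refl g)) (subst (λ z → (z ≡ᵇ g) ≡ false) (trans (+-comm prev 1) e) eq))
      below : ∀ j → 1 ≤ j → j < mex W → elemℕ j S ≡ true
      below j p l with j ≟ g
      ... | no  j≢g  = trans (agree j j≢g) (IsMex.below M j p l)
      -- A mex of `W` beyond `g` requires `g - 1` in `W`, hence in `S`, so `g - 1` is at most
      -- `prev`. As the exception does not apply, `prev` is at least `g`, and `g` has been used.
      ... | yes refl with gap (suc g₂) (trans (agree (suc g₂) (λ ())) (IsMex.below M (suc g₂) (s≤s z≤n) (<-trans (n<1+n _) l)))
      ...   | inj₂ l′ = ⊥-elim (<⇒≱ l′ (n≤1+n _))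
      ...   | inj₁ l′ = full g p (≤∧≢⇒< l′ (λ e → prev≢ (cong suc (sym e))))

    next : ∀ {prev W S m} → Inv prev W S → IsMex m S → Inv m (m ∷ W) (m ∷ S)
    next {prev} {W} {S} {m} (inv agree g∈W full gap) (isMex pos fresh below) = inv
      (λ j ne → cong ((j ≡ᵇ m) ∨_) (agree j ne)) (elem-there m W g∈W) full′ gap′
      where
      prev<m : prev < m
      prev<m = ≰⇒> (λ l → true≢false (trans (sym (full m pos l)) fresh))
      full′ : ∀ j → 1 ≤ j → j ≤ m → elemℕ j (m ∷ S) ≡ true
      full′ j p l with m≤n⇒m<n∨m≡n l
      ... | inj₁ j<m  = elem-there m S (below j p j<m)
      ... | inj₂ refl = elem-here m S
      gap′ : ∀ j → elemℕ j (m ∷ S) ≡ true → j ≤ m ⊎ g < j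
      gap′ j h with elem-∷⁻ m S h
      ... | inj₁ refl = inj₁ ≤-refl
      ... | inj₂ h′ with gap j h′
      ...   | inj₁ l = inj₁ (≤-trans l (<⇒≤ prev<m))
      ...   | inj₂ l = inj₂ l

    evens-exceptional : ∀ {prior prev W Z S} c rest → Window a X prior W Z → Z ⊑ S → Inv prev W S →
      Evens lam r a X prior prev Z (free r S) c rest
    evens-exceptional c rest w s i = MexChain.chain lam r a X Inv step c rest w i s
      where
      step : ∀ {prior W Z prev S} → Window a X prior W Z → Inv prev W S →
        let m = markOf lam prior prev (2 + a , false) in IsMex m S × Inv m (m ∷ W) (m ∷ S)
      step {prior} {W = W} {prev = prev} {S = S} w i =
        subst (λ m → IsMex m S × Inv m (m ∷ W) (m ∷ S)) (sym mark≡) (mark-isMex i , next i (mark-isMex i))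
        where
        mark≡ : markOf lam prior prev (2 + a , false) ≡ mark prev W
        mark≡ = trans (markOf-window prev w)
          (cong₂ (λ b g → if b then g else mex W) (on prev) min)

remove : ℕ → List ℕ → List ℕ
remove g []      = []
remove g (x ∷ X) = if g ≡ᵇ x then remove g X else x ∷ remove g X

elem-remove : ∀ g X → elemℕ g (remove g X) ≡ false
elem-remove g [] = refl
elem-remove g (x ∷ X) with g ≡ᵇ x in e
... | true  = elem-remove g X
... | false rewrite e = elem-remove g X

elem-remove-≢ : ∀ g X j → j ≢ g → elemℕ j (remove g X) ≡ elemℕ j X
elem-remove-≢ g [] j ne = refl
elem-remove-≢ g (x ∷ X) j ne with g ≡ᵇ x in e
... | true rewrite ≡ᵇ-≢ (λ j≡x → ne (trans j≡x (sym (≡ᵇ-true g x e)))) = elem-remove-≢ g X j ne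
... | false = cong ((j ≡ᵇ x) ∨_) (elem-remove-≢ g X j ne)

-- Rule (d) amounts to taking mexes as if 1 were used instead of the least mark g of size a.
swapped : ℕ → List ℕ → List ℕ
swapped g X = 1 ∷ remove g X

-- If `g ≤ r`, exchanging `g` for 1 preserves the number of free values, and it is at most `q`
-- because `g` is used. If `g > r`, nothing up to `r` was used and only 1 is lost.
free-swapped : ∀ q g₂ X → elemℕ (2 + g₂) X ≡ true → (∀ j → elemℕ j X ≡ true → 2 + g₂ ≤ j) →
  free (suc q) (swapped (2 + g₂) X) ≡ free (suc q) X ⊓ q
free-swapped q g₂ X g∈X least with g ≤? r
  where
  g = 2 + g₂
  r = suc q
... | yes g≤r = trans φ≡ρ (sym (m≤n⇒m⊓n≡m ρ≤q))
  where
  g = 2 + g₂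
  r = suc q
  removed : free r (remove g X) ≡ suc (free r X)
  removed = trans (free-∷ r g (remove g X) (elem-remove g X))
    (cong₂ _+_ (ind-≥ (s≤s z≤n) g≤r) (free-cong r same))
    where
    same : ∀ j → elemℕ j (g ∷ remove g X) ≡ elemℕ j X
    same j with j ≡ᵇ g in e
    ... | true rewrite ≡ᵇ-true j g e = sym g∈X
    ... | false = elem-remove-≢ g X j (λ { refl → true≢false (trans (sym (≡ᵇ-refl g)) e) })
  1∉ : elemℕ 1 (remove g X) ≡ false
  1∉ with elemℕ 1 (remove g X) in e
  ... | false = refl
  ... | true with least 1 (trans (sym (elem-remove-≢ g X 1 (λ ()))) e)
  ...   | s≤s ()
  φ≡ρ : free r (swapped g X) ≡ free r X
  φ≡ρ = suc-injective (trans (sym (trans (free-∷ r 1 (remove g X) 1∉)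
    (cong (_+ free r (1 ∷ remove g X)) (ind-≥ {r} ≤-refl (s≤s z≤n))))) removed)
  ρ≤q : free r X ≤ q
  ρ≤q = s≤s⁻¹ (≤-trans (≤-reflexive (sym removed)) (free-≤ r (remove g X)))
... | no g≰r = trans φ≡q (sym (trans (cong (_⊓ q) ρ≡r) (m≥n⇒m⊓n≡n (n≤1+n q))))
  where
  g = 2 + g₂
  r = suc q
  low : ∀ j → j ≤ r → elemℕ j X ≡ false
  low j l with elemℕ j X in e
  ... | false = refl
  ... | true  = ⊥-elim (g≰r (≤-trans (least j e) l))
  ρ≡r : free r X ≡ r
  ρ≡r = free-empty r X (λ j _ l → low j l)
  low′ : ∀ j → j ≤ r → elemℕ j (remove g X) ≡ false
  low′ j l = trans (elem-remove-≢ g X j (λ { refl → g≰r l })) (low j l)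
  φ≡q : free r (swapped g X) ≡ q
  φ≡q = suc-injective (trans (sym (trans (free-∷ r 1 (remove g X) (low′ 1 (s≤s z≤n)))
    (cong (_+ free r (1 ∷ remove g X)) (ind-≥ {r} ≤-refl (s≤s z≤n)))))
    (free-empty r (remove g X) (λ j _ l → low′ j l)))

-- The marks of one column

-- Several bad parts act like a single one: the last mark is 1, and the marks met gain the element 1
-- only.
bad-cases : ∀ n b → (n ≡ 0 × b ≡ false) ⊎
  (bad n b ≡ 1 × ((0 <ᵇ n) ∨ b) ≡ true × (∀ prev → lastMark (val b) (lastMark n prev) ≡ 1)
   × (∀ j W → elemℕ j (ones (val b) (ones n W)) ≡ elemℕ j (1 ∷ W)))
bad-cases zero    false = inj₁ (refl , refl)
bad-cases zero    true  = inj₂ (refl , refl , (λ _ → refl) , λ _ _ → refl)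
bad-cases (suc n) false = inj₂ (refl , refl , (λ _ → refl) , elem-ones-suc n)
bad-cases (suc n) true  = inj₂ (refl , refl , (λ _ → refl) , λ j W →
  trans (cong ((j ≡ᵇ 1) ∨_) (elem-ones-suc n j W)) (absorb (j ≡ᵇ 1) (elemℕ j W)))
  where
  absorb : ∀ x y → x ∨ (x ∨ y) ≡ x ∨ y
  absorb true  y = refl
  absorb false y = refl

ones-⊑ : ∀ b {Y} → (b ≡ true → elemℕ 1 Y ≡ true) → ones (val b) [] ⊑ Y
ones-⊑ true  h j e with elem-∷⁻ {j} 1 [] e
... | inj₁ refl = h refl

free-ones-[] : ∀ q b → free (suc q) (ones (val b) []) ≡ suc q ∸ val b
free-ones-[] q false = free-[] (suc q)
free-ones-[] q true  = suc-injective (trans (sym (trans (free-∷ (suc q) 1 [] refl)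
  (cong (_+ free (suc q) (1 ∷ [])) (ind-≥ {suc q} ≤-refl (s≤s z≤n))))) (free-[] (suc q)))

module ColumnMarks (lam : List Part) (q a : ℕ) (ev : isEven a ≡ true)
  (prior : Marked) (small : All (λ p → size (proj₁ p) ≤ a) prior)
  (positive : All (1 ≤_) (marksWhere (_≡ᵇ a) prior)) where

  private
    r = suc q
    X = marksWhere (_≡ᵇ a) prior
    ρ = free r X

  afterBads : ℕ → Bool → Marked → Marked
  afterBads n b prior = pushOnes (val b) (2 + a , true) (pushOnes n (1 + a , false) prior)

  lastBad : ℕ → Bool → ℕ → ℕ
  lastBad n b prev = lastMark (val b) (lastMark n prev)

  window-bads : ∀ n b {prior W} → Window a X prior W [] →
    Window a X (afterBads n b prior) (ones (val b) (ones n W)) (ones (val b) [])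
  window-bads n b w = window-evens (val b) true (window-odds n false w)

  -- An overlined odd part switches the exception off. Mark 1 is then already met, so bad parts cost
  -- nothing further, and `ρ ∸ 1` is below the cap anyway.
  evens-true : ∀ n b c rest prev {prior₁ W} → occurs (1 + a , true) lam ≡ true →
    Window a X prior₁ W [] → elemℕ 1 W ≡ true → free r W ≡ ρ ∸ 1 →
    Evens lam r a X (afterBads n b prior₁) (lastBad n b prev) (ones (val b) [])
      ((ρ ∸ 1) ⊓ (r ∸ bad n b)) c rest
  evens-true n b c rest prev {prior₁} {W} occ w one fr =
    subst (λ φ → Evens lam r a X (afterBads n b prior₁) (lastBad n b prev) (ones (val b) []) φ c rest)
      φ≡ (evens-regular lam r a ev X c rest (window-bads n b w) (ones-⊑ b {ones (val b) (ones n W)} (λ _ → elem-ones (val b) 1 (ones n W) (elem-ones n 1 W one))) off)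
    where
    off : ∀ prev → exceptional lam a (minPos X) prev ≡ false
    off prev rewrite occ | ∧-zeroʳ (occurs (1 + a , false) lam ∨ occurs (2 + a , true) lam)
      | ∧-zeroʳ (prev + 1 ≡ᵇ minPos X) = ∧-zeroʳ (2 ≤ᵇ minPos X)
    bad≤1 : ∀ n b → bad n b ≤ 1
    bad≤1 zero    b = val≤1 b
    bad≤1 (suc n) b = ≤-refl
    φ≡ : free r (ones (val b) (ones n W)) ≡ (ρ ∸ 1) ⊓ (r ∸ bad n b)
    φ≡ = trans (free-ones r (val b) (elem-ones n 1 W one)) (trans (free-ones r n one) (trans fr
      (sym (m≤n⇒m⊓n≡m (∸-mono (free-≤ r X) (bad≤1 n b))))))

  -- By the least mark `g` of size `a`: if there is none, or if it is 1, the exception cannot occur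
  -- and mark 1 simply joins `X`; from 2 on, the exceptional chain starts at `swapped g X`.
  evens-false : ∀ n b c rest prev → occurs (1 + a , true) lam ≡ false →
    occurs (1 + a , false) lam ≡ (0 <ᵇ n) → occurs (2 + a , true) lam ≡ b →
    Evens lam r a X (afterBads n b prior) (lastBad n b prev) (ones (val b) []) (ρ ⊓ (r ∸ bad n b)) c rest
  evens-false n b c rest prev occ-o occ-n occ-b with bad-cases n b
  ... | inj₁ (refl , refl) =
    subst (λ φ → Evens lam r a X prior prev [] φ c rest) (sym (m≤n⇒m⊓n≡m (free-≤ r X)))
      (evens-regular lam r a ev X c rest (window-start a prior small) (λ _ ()) off)
    where
    off : ∀ prev → exceptional lam a (minPos X) prev ≡ false
    off prev rewrite occ-n | occ-b | ∧-zeroʳ (prev + 1 ≡ᵇ minPos X) = ∧-zeroʳ (2 ≤ᵇ minPos X)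
  ... | inj₂ (bad≡1 , occ , last≡1 , elem≡) rewrite bad≡1 = go (minPos X) refl
    where
    W₃ = ones (val b) (ones n X)
    w₃ : Window a X (afterBads n b prior) W₃ (ones (val b) [])
    w₃ = window-bads n b (window-start a prior small)
    Goal : ℕ → Set
    Goal φ = Evens lam r a X (afterBads n b prior) (lastBad n b prev) (ones (val b) []) φ c rest
    one : elemℕ 1 W₃ ≡ true
    one = trans (elem≡ 1 X) (elem-here 1 X)
    regular : (∀ prev → exceptional lam a (minPos X) prev ≡ false) → Goal (free r (1 ∷ X))
    regular off = subst Goal (free-cong r (λ j → elem≡ j X))
      (evens-regular lam r a ev X c rest w₃ (ones-⊑ b {W₃} (λ _ → one)) off)
    1∷ : elemℕ 1 X ≡ false → suc (free r (1 ∷ X)) ≡ ρ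
    1∷ e = sym (trans (free-∷ r 1 X e) (cong (_+ free r (1 ∷ X)) (ind-≥ {r} ≤-refl (s≤s z≤n))))
    go : ∀ g → minPos X ≡ g → Goal (ρ ⊓ q)
    go zero e = subst Goal φ≡ (regular (λ prev → cong (λ g → exceptional lam a g prev) e))
      where
      X≡[] : X ≡ []
      X≡[] = minPos-zero X positive e
      φ≡ : free r (1 ∷ X) ≡ ρ ⊓ q
      φ≡ = trans (suc-injective (trans (1∷ (cong (elemℕ 1) X≡[])) ρ≡r))
        (sym (trans (cong (_⊓ q) ρ≡r) (m≥n⇒m⊓n≡n (n≤1+n q))))
        where
        ρ≡r : ρ ≡ r
        ρ≡r = trans (cong (free r) X≡[]) (free-[] r)
    go (suc zero) e = subst Goal φ≡ (regular (λ prev → cong (λ g → exceptional lam a g prev) e))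
      where
      1∈X = proj₁ (minPos-least X 0 positive e)
      ρ≤q : ρ ≤ q
      ρ≤q = ≤-trans (≤-reflexive (trans (sym (free-absorb r 1 X 1∈X)) (free-cong r same)))
        (s≤s⁻¹ (≤-trans (≤-reflexive (sym (trans (free-∷ r 1 (remove 1 X) (elem-remove 1 X))
          (cong (_+ free r (1 ∷ remove 1 X)) (ind-≥ {r} ≤-refl (s≤s z≤n)))))) (free-≤ r (remove 1 X))))
        where
        same : ∀ j → elemℕ j (1 ∷ X) ≡ elemℕ j (1 ∷ remove 1 X)
        same j with j ≡ᵇ 1 in eq
        ... | true  = refl
        ... | false = sym (elem-remove-≢ 1 X j (λ { refl → true≢false eq }))
      φ≡ : free r (1 ∷ X) ≡ ρ ⊓ q
      φ≡ = trans (free-absorb r 1 X 1∈X) (sym (m≤n⇒m⊓n≡m ρ≤q))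
    go (suc (suc g₂)) e = subst Goal (free-swapped q g₂ X g∈X least)
      (evens-exceptional c rest w₃ (ones-⊑ b {swapped g X} (λ _ → refl))
        (subst (λ z → Inv z W₃ (swapped g X)) (sym (last≡1 prev)) (inv agree g∈W full gap)))
      where
      g = suc (suc g₂)
      g∈X = proj₁ (minPos-least X (suc g₂) positive e)
      least = proj₂ (minPos-least X (suc g₂) positive e)
      on : ∀ prev → exceptional lam a (minPos X) prev ≡ (prev + 1 ≡ᵇ g)
      on prev rewrite e | occ-o | occ-n | occ-b | occ = ∧-identityʳ (prev + 1 ≡ᵇ g)
      open Exceptional lam r a ev X g₂ e on
      agree : ∀ j → j ≢ g → elemℕ j (swapped g X) ≡ elemℕ j W₃
      agree j ne = trans (cong ((j ≡ᵇ 1) ∨_) (elem-remove-≢ g X j ne)) (sym (elem≡ j X))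
      g∈W : elemℕ g W₃ ≡ true
      g∈W = trans (elem≡ g X) (elem-there {g} 1 X g∈X)
      full : ∀ j → 1 ≤ j → j ≤ 1 → elemℕ j (swapped g X) ≡ true
      full (suc zero) _ _ = refl
      full (suc (suc j)) _ (s≤s ())
      gap : ∀ j → elemℕ j (swapped g X) ≡ true → j ≤ 1 ⊎ g < j
      gap j h with elem-∷⁻ {j} 1 (remove g X) h
      ... | inj₁ refl = inj₁ ≤-refl
      ... | inj₂ h′ with j ≟ g
      ...   | yes refl = ⊥-elim (true≢false (trans (sym h′) (elem-remove g X)))
      ...   | no  ne = inj₂ (≤∧≢⇒< (least j (trans (sym (elem-remove-≢ g X j ne)) h′)) (λ e → ne (sym e)))

record ColumnMarked (lam : List Part) (r a : ℕ) (prior : Marked) (prev : ℕ)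
  (o : Bool) (n : ℕ) (b : Bool) (c : ℕ) (rest : List Part) : Set where
  constructor columnMarked
  private
    ρ = free r (marksWhere (_≡ᵇ a) prior)
    k = accepted r ρ (col o n b c)
  field
    prior′ : Marked
    prev′  : ℕ
    counts : markedUpTo r (marksGo lam prior prev (colParts a (col o n b c) rest))
             ≡ (val o ⊓ ρ) + (n + (k + markedUpTo r (marksGo lam prior′ prev′ rest)))
    small′ : All (λ p → size (proj₁ p) ≤ 2 + a) prior′
    pos′   : All (1 ≤_) (marksWhere (_≡ᵇ (2 + a)) prior′)
    free′  : free r (marksWhere (_≡ᵇ (2 + a)) prior′) ≡ r ∸ k

module _ (lam : List Part) (q a : ℕ) (ev : isEven a ≡ true)
  (prior : Marked) (small : All (λ p → size (proj₁ p) ≤ a) prior)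
  (positive : All (1 ≤_) (marksWhere (_≡ᵇ a) prior)) where

  open ColumnMarks lam q a ev prior small positive
  private
    r = suc q
    X = marksWhere (_≡ᵇ a) prior
    ρ = free r X

  count-bads : ∀ n b prior₁ prev₁ rest →
    markedUpTo r (marksGo lam prior₁ prev₁ (replicate n (1 + a , false) ++ replicate (val b) (2 + a , true) ++ rest))
    ≡ n + (val b + markedUpTo r (marksGo lam (afterBads n b prior₁) (lastBad n b prev₁) rest))
  count-bads n b prior₁ prev₁ rest = trans
    (marksGo-ones lam q (1 + a , false) (λ p v → markOf-odd lam p v {1 + a} (isEven-suc a ev)) n prior₁ prev₁ _)
    (cong (n +_) (marksGo-ones lam q (2 + a , true) (λ p v → markOf-bar-even lam p v ev) (val b) _ _ rest))

  module _ (o : Bool) (n : ℕ) (b : Bool) (c : ℕ) (rest : List Part) (prev prev₁ : ℕ) (prior₁ : Marked)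
    (first : markedUpTo r (marksGo lam prior prev (colParts a (col o n b c) rest))
      ≡ (val o ⊓ ρ) + markedUpTo r (marksGo lam prior₁ prev₁ (colParts a (col false n b c) rest)))
    (E : Evens lam r a X (afterBads n b prior₁) (lastBad n b prev₁) (ones (val b) [])
      ((ρ ∸ val o) ⊓ (r ∸ bad n b)) c rest) where
    open Evens E
    private
      φ = (ρ ∸ val o) ⊓ (r ∸ bad n b)
      k = accepted r ρ (col o n b c)
      k≡ : val b + (c ⊓ φ) ≡ k
      k≡ = cong (val b +_) (sym (⊓-assoc c (ρ ∸ val o) (r ∸ bad n b)))

    finish : ColumnMarked lam r a prior prev o n b c rest
    finish = columnMarked prior′ prev′ counts′ (Window.sizes win)
      (subst (All (1 ≤_)) (sym (Window.top win)) (pos (All-ones (val b) [])))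
      (trans (cong (free r) (Window.top win)) frees′)
      where
      open ≡-Reasoning
      M = markedUpTo r (marksGo lam prior′ prev′ rest)
      counts′ : _ ≡ (val o ⊓ ρ) + (n + (k + M))
      counts′ = trans first (cong ((val o ⊓ ρ) +_) (begin
        _ ≡⟨ count-bads n b prior₁ prev₁ (replicate c (2 + a , false) ++ rest) ⟩
        n + (val b + _) ≡⟨ cong (λ z → n + (val b + z)) counts ⟩
        n + (val b + ((c ⊓ φ) + M)) ≡⟨ cong (n +_) (sym (+-assoc (val b) (c ⊓ φ) M)) ⟩
        n + (val b + (c ⊓ φ) + M) ≡⟨ cong (λ z → n + (z + M)) k≡ ⟩
        n + (k + M) ∎))
      frees′ : free r Z′ ≡ r ∸ k
      frees′ = begin
        free r Z′ ≡⟨ sym (m+n∸m≡n (c ⊓ φ) (free r Z′)) ⟩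
        (c ⊓ φ) + free r Z′ ∸ (c ⊓ φ) ≡⟨ cong (_∸ (c ⊓ φ)) (trans (sym frees) (free-ones-[] q b)) ⟩
        r ∸ val b ∸ (c ⊓ φ) ≡⟨ ∸-+-assoc r (val b) (c ⊓ φ) ⟩
        r ∸ (val b + (c ⊓ φ)) ≡⟨ cong (r ∸_) k≡ ⟩
        r ∸ k ∎

  mark-column : ∀ o n b c rest prev → occurs (1 + a , true) lam ≡ o →
    occurs (1 + a , false) lam ≡ (0 <ᵇ n) → occurs (2 + a , true) lam ≡ b →
    ColumnMarked lam r a prior prev o n b c rest
  mark-column false n b c rest prev occ-o occ-n occ-b =
    finish false n b c rest prev prev prior refl (evens-false n b c rest prev occ-o occ-n occ-b)
  mark-column true n b c rest prev occ-o _ _ =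
    finish true n b c rest prev m (((1 + a , true) , m) ∷ prior)
      (trans (markedUpTo-∷ r m _) (cong (_+ markedUpTo r (marksGo lam (((1 + a , true) , m) ∷ prior) m (colParts a (col false n b c) rest))) (ind-mex r M)))
      (evens-true n b c rest m occ-o (window-odd true m (window-start a prior small)) one (free-mex r M))
    where
    m = markOf lam prior prev (1 + a , true)
    M : IsMex m X
    M = subst (λ z → IsMex z X) (sym (trans (markOf-bar-odd lam prior prev (isEven-suc a ev))
      (cong mex (marksWhere-cong prior (All.universal (λ p → +1-≡ᵇ (size (proj₁ p)) a) prior))))) (mex-correct X)
    one : elemℕ 1 (m ∷ X) ≡ true
    one with m≤n⇒m<n∨m≡n (IsMex.pos M)
    ... | inj₁ 1<m = elem-there {1} m X (IsMex.below M 1 ≤-refl 1<m)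
    ... | inj₂ 1≡m rewrite sym 1≡m = refl

-- The marks of all columns

<ᵇ-val : ∀ b → (0 <ᵇ val b) ≡ b
<ᵇ-val false = refl
<ᵇ-val true  = refl

-- Rule (d) asks about occurrences in all of `lam`; the last hypothesis reads those of sizes above
-- `a` off the remaining columns.
marksGo-greedy : ∀ lam q a cs prior prev → isEven a ≡ true →
  All (λ p → size (proj₁ p) ≤ a) prior → All (1 ≤_) (marksWhere (_≡ᵇ a) prior) →
  (∀ d β → count (suc d + a , β) lam ≡ count (suc d , β) (parts 0 cs)) →
  markedUpTo (suc q) (marksGo lam prior prev (parts a cs))
  ≡ greedyC (suc q) (free (suc q) (marksWhere (_≡ᵇ a) prior)) cs
marksGo-greedy lam q a [] prior prev ev small positive occ = zeros (suc q)
  where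
  zeros : ∀ r → markedUpTo r [] ≡ 0
  zeros zero    = refl
  zeros (suc r) = zeros r
marksGo-greedy lam q a (col o n b c ∷ cs) prior prev ev small positive occ = trans counts
  (cong (λ z → (val o ⊓ ρ) + (n + (k + z)))
    (trans (marksGo-greedy lam q (2 + a) cs prior′ prev′ ev small′ pos′ occ′)
      (cong (λ z → greedyC r z cs) free′)))
  where
  r = suc q
  ρ = free r (marksWhere (_≡ᵇ a) prior)
  k = accepted r ρ (col o n b c)
  occurs≡ : ∀ d β {v} → count (suc d , β) (parts 0 (col o n b c ∷ cs)) ≡ v →
    occurs (suc d + a , β) lam ≡ (0 <ᵇ v)
  occurs≡ d β e = trans (occurs-count (suc d + a , β) lam) (cong (0 <ᵇ_) (trans (occ d β) e))
  open ColumnMarked (mark-column lam q a ev prior small positive o n b c (parts (2 + a) cs) prev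
    (trans (occurs≡ 0 true (f̄₁ o n b c cs)) (<ᵇ-val o))
    (occurs≡ 0 false (f₁ o n b c cs))
    (trans (occurs≡ 1 true (f̄₂ o n b c cs)) (<ᵇ-val b)))
  occ′ : ∀ d β → count (suc d + (2 + a) , β) lam ≡ count (suc d , β) (parts 0 cs)
  occ′ d β = trans (cong (λ z → count (suc z , β) lam) (trans (+-suc d (suc a)) (cong suc (+-suc d a))))
    (trans (occ (2 + d) β) (count-tail d β (col o n b c) cs))

markOf-first : ∀ lam prev p → markOf lam [] prev p ≡ 1
markOf-first lam prev (s , true) with isEven s
... | true  = refl
... | false = refl
markOf-first lam prev (s , false) with isEven s
... | true  = refl
... | false = refl

marks-marksGo : ∀ lam → marks lam ≡ marksGo lam [] 0 lam
marks-marksGo [] = refl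
marks-marksGo (p ∷ ps) rewrite markOf-first (p ∷ ps) 0 p = refl

marks-greedy : ∀ q cs → markedUpTo (suc q) (marks (parts 0 cs)) ≡ greedyC (suc q) (suc q) cs
marks-greedy q cs = begin
  markedUpTo (suc q) (marks (parts 0 cs))
    ≡⟨ cong (markedUpTo (suc q)) (marks-marksGo (parts 0 cs)) ⟩
  markedUpTo (suc q) (marksGo (parts 0 cs) [] 0 (parts 0 cs))
    ≡⟨ marksGo-greedy (parts 0 cs) q 0 cs [] 0 refl [] []
         (λ d β → cong (λ z → count (suc z , β) (parts 0 cs)) (+-identityʳ d)) ⟩
  greedyC (suc q) (free (suc q) []) cs
    ≡⟨ cong (λ z → greedyC (suc q) z cs) (free-[] (suc q)) ⟩
  greedyC (suc q) (suc q) cs ∎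
  where open ≡-Reasoning

-- The bijection

-- Conditions (2) and (3) for k = r + 1, where s counts the even parts of the previous column.
Sat : ℕ → ℕ → List Col → Set
Sat r s []                   = s ≤ r
Sat r s (col o n b c ∷ cs) =
  s + (val o + c) ≤ r × (1 ≤ n → c + 1 ≤ r) × Sat r (val b + c) cs

accepted≤ : ∀ r ρ o n b c → accepted r ρ (col o n b c) ≤ val b + c
accepted≤ r ρ o n b c = +-monoʳ-≤ (val b) (≤-trans (m⊓n≤m _ _) (m⊓n≤m c _))

greedyC≤numberC : ∀ r ρ cs → greedyC r ρ cs ≤ numberC cs
greedyC≤numberC r ρ [] = z≤n
greedyC≤numberC r ρ (col o n b c ∷ cs) = +-mono-≤ (m⊓n≤m (val o) ρ) (+-monoʳ-≤ n
  (≤-trans (+-mono-≤ (accepted≤ r ρ o n b c) (greedyC≤numberC r _ cs)) (≤-reflexive (+-assoc (val b) c _))))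

squeeze : ∀ {a a′ b b′} → a ≤ a′ → b ≤ b′ → a + b ≡ a′ + b′ → a ≡ a′ × b ≡ b′
squeeze {a} {a′} {b} {b′} l l′ e = a≡ , +-cancelˡ-≡ a b b′ (trans e (cong (_+ b′) (sym a≡)))
  where
  a≡ : a ≡ a′
  a≡ = ≤-antisym l (+-cancelʳ-≤ b a′ a (≤-trans (+-monoʳ-≤ a′ l′) (≤-reflexive (sym e))))

-- Each greedy term is at most the number of parts it selects from, so equal totals force equality
-- term by term. No part is refused, and the room and the cap become conditions (2) and (3).
saturated : ∀ q cs {s} → s ≤ suc q → greedyC (suc q) (suc q ∸ s) cs ≡ numberC cs → Sat (suc q) s cs
saturated q [] s≤r _ = s≤r
saturated q (col o n b c ∷ cs) {s} s≤r e = s+o+c≤r , c<r , saturated q cs b+c≤r rest≡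
  where
  r = suc q
  ρ = r ∸ s
  k = accepted r ρ (col o n b c)
  eqs : (val o ⊓ ρ ≡ val o) × (n + (k + greedyC r (r ∸ k) cs) ≡ n + (val b + (c + numberC cs)))
  eqs = squeeze (m⊓n≤m (val o) ρ) (+-monoʳ-≤ n (≤-trans (+-mono-≤ (accepted≤ r ρ o n b c) (greedyC≤numberC r _ cs))
    (≤-reflexive (+-assoc (val b) c _)))) e
  eqs′ : (k ≡ val b + c) × (greedyC r (r ∸ k) cs ≡ numberC cs)
  eqs′ = squeeze (accepted≤ r ρ o n b c) (greedyC≤numberC r _ cs)
    (trans (+-cancelˡ-≡ n _ _ (proj₂ eqs)) (sym (+-assoc (val b) c _)))
  rest≡ : greedyC r (r ∸ (val b + c)) cs ≡ numberC cs
  rest≡ = trans (cong (λ z → greedyC r (r ∸ z) cs) (sym (proj₁ eqs′))) (proj₂ eqs′)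
  c≡ : c ⊓ (ρ ∸ val o) ⊓ (r ∸ bad n b) ≡ c
  c≡ = +-cancelˡ-≡ (val b) _ _ (proj₁ eqs′)
  c≤room : c ≤ ρ ∸ val o
  c≤room = ≤-trans (≤-reflexive (sym c≡)) (≤-trans (m⊓n≤m _ _) (m⊓n≤n c _))
  c≤bad : c ≤ r ∸ bad n b
  c≤bad = ≤-trans (≤-reflexive (sym c≡)) (m⊓n≤n _ _)
  o≤ρ : val o ≤ ρ
  o≤ρ = ≤-trans (≤-reflexive (sym (proj₁ eqs))) (m⊓n≤n (val o) ρ)
  s+o+c≤r : s + (val o + c) ≤ r
  s+o+c≤r = begin
    s + (val o + c)           ≤⟨ +-monoʳ-≤ s (+-monoʳ-≤ (val o) c≤room) ⟩
    s + (val o + (ρ ∸ val o)) ≡⟨ cong (s +_) (m+[n∸m]≡n o≤ρ) ⟩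
    s + (r ∸ s)               ≡⟨ m+[n∸m]≡n s≤r ⟩
    r                         ∎
    where open ≤-Reasoning
  c<r : 1 ≤ n → c + 1 ≤ r
  c<r (s≤s _) = ≤-trans (≤-reflexive (+-comm c 1)) (s≤s c≤bad)
  b≤bad : ∀ n b → val b ≤ bad n b
  b≤bad zero    b = ≤-refl
  b≤bad (suc n) b = val≤1 b
  b+c≤r : val b + c ≤ r
  b+c≤r = begin
    val b + c           ≤⟨ +-monoʳ-≤ (val b) (≤-trans c≤bad (∸-monoʳ-≤ r (b≤bad n b))) ⟩
    val b + (r ∸ val b) ≡⟨ m+[n∸m]≡n (≤-trans (val≤1 b) (s≤s z≤n)) ⟩
    r                   ∎
    where open ≤-Reasoning

double : ℕ → ℕ
double zero    = 0
double (suc t) = suc (suc (double t))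

2*≡double : ∀ t → 2 * t ≡ double t
2*≡double zero    = refl
2*≡double (suc t) = cong suc (trans (+-suc t (t + 0)) (cong suc (2*≡double t)))

coverage : ℕ → List Part → ℕ
coverage a ps = f̄ a ps + f a ps + f̄ (1 + a) ps + f (2 + a) ps

f̄₁+f₂ : ∀ {r s} cs → Sat r s cs → s + f̄ 1 (parts 0 cs) + f 2 (parts 0 cs) ≤ r
f̄₁+f₂ {r} {s} [] h rewrite +-identityʳ s | +-identityʳ s = h
f̄₁+f₂ {r} {s} (col o n b c ∷ cs) (h , _) rewrite f̄₁ o n b c cs | f₂ o n b c cs | +-assoc s (val o) c = h

sat-coverage₊ : ∀ {r s} t cs → Sat r s cs → coverage (double (suc t)) (parts 0 cs) ≤ r
sat-coverage₊ t [] _ = z≤n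
sat-coverage₊ zero (h@(col o n b c) ∷ cs) (_ , _ , S)
  rewrite f̄₂ o n b c cs | f₂ o n b c cs | count-tail 0 true h cs | count-tail 1 false h cs = f̄₁+f₂ cs S
sat-coverage₊ (suc t) (h@(col _ _ _ _) ∷ cs) (_ , _ , S)
  rewrite count-tail (1 + double t) true h cs | count-tail (1 + double t) false h cs
        | count-tail (2 + double t) true h cs | count-tail (3 + double t) false h cs = sat-coverage₊ t cs S

sat-coverage : ∀ {r} t cs → Sat r 0 cs → coverage (double t) (parts 0 cs) ≤ r
sat-coverage zero cs S rewrite count-low true cs (z≤n {0}) | count-low false cs (z≤n {0}) = f̄₁+f₂ cs S
sat-coverage (suc t) cs S = sat-coverage₊ t cs S

sat-odd : ∀ {r s} t cs → Sat r s cs → 1 ≤ f (1 + double t) (parts 0 cs) → f (2 + double t) (parts 0 cs) + 1 ≤ r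
sat-odd zero (h@(col o n b c) ∷ cs) (_ , c<r , _) rewrite f₁ o n b c cs | f₂ o n b c cs = c<r
sat-odd (suc t) (h@(col _ _ _ _) ∷ cs) (_ , _ , S)
  rewrite count-tail (double t) false h cs | count-tail (1 + double t) false h cs = sat-odd t cs S

start⇒smallest : ∀ a cs → isEven a ≡ true → StartOK cs → SmallestOK (parts a cs)
start⇒smallest a (col true _ _ _ ∷ cs) ev _ = inj₁ (refl , isEven-suc a ev)
start⇒smallest a (col false 0 false (suc _) ∷ cs) ev _ = inj₂ (refl , ev)
start⇒smallest a (col false 0 false 0 ∷ cs) ev s = start⇒smallest (2 + a) cs ev s

smallest⇒start : ∀ a cs → isEven a ≡ true → SmallestOK (parts a cs) → StartOK cs
smallest⇒start a (col true _ _ _ ∷ cs) ev _ = tt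
smallest⇒start a (col false (suc _) _ _ ∷ cs) ev (inj₁ (() , _))
smallest⇒start a (col false (suc _) _ _ ∷ cs) ev (inj₂ (_ , e)) =
  ⊥-elim (true≢false (trans (sym e) (isEven-suc a ev)))
smallest⇒start a (col false 0 true _ ∷ cs) ev (inj₁ (_ , e)) = ⊥-elim (true≢false (trans (sym ev) e))
smallest⇒start a (col false 0 true _ ∷ cs) ev (inj₂ (() , _))
smallest⇒start a (col false 0 false (suc _) ∷ cs) ev _ = tt
smallest⇒start a (col false 0 false 0 ∷ cs) ev s = smallest⇒start (2 + a) cs ev s

NotBarEven NotPlainOdd : Part → Set
NotBarEven  p = ¬ (proj₂ p ≡ true × isEven (size p) ≡ true)
NotPlainOdd p = ¬ (proj₂ p ≡ false × isEven (size p) ≡ false)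

parts-good : ∀ a cs → isEven a ≡ true → All NotBarEven (parts a cs) → All NotPlainOdd (parts a cs) →
  ∃ λ g → ups g ≡ cs
parts-good a [] _ _ _ = [] , refl
parts-good a (col o n b c ∷ cs) ev hb hn with n | b
  | All.++⁻ʳ (replicate (val o) (1 + a , true)) hb | All.++⁻ʳ (replicate (val o) (1 + a , true)) hn
... | suc n′ | _ | _ | h ∷ _ = ⊥-elim (h (refl , isEven-suc a ev))
... | zero | true | h ∷ _ | _ = ⊥-elim (h (refl , ev))
... | zero | false | hb′ | hn′
  with parts-good (2 + a) cs ev (All.++⁻ʳ (replicate c (2 + a , false)) hb′) (All.++⁻ʳ (replicate c (2 + a , false)) hn′)
...   | g , refl = (o , c) ∷ g , refl

good-parts : ∀ a g → isEven a ≡ true →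
  All NotBarEven (parts a (ups g)) × All NotPlainOdd (parts a (ups g))
good-parts a [] _ = [] , []
good-parts a ((o , c) ∷ g) ev =
  All.++⁺ (All.replicate⁺ (val o) (λ (_ , e) → true≢false (trans (sym e) (isEven-suc a ev))))
    (All.++⁺ (All.replicate⁺ c (λ ())) (proj₁ (good-parts (2 + a) g ev))) ,
  All.++⁺ (All.replicate⁺ (val o) (λ ()))
    (All.++⁺ (All.replicate⁺ c (λ (_ , e) → true≢false (trans (sym ev) e))) (proj₂ (good-parts (2 + a) g ev)))

ups-canonical : ∀ g → Canonical g → CanonicalC (ups g)
ups-canonical [] _ = tt
ups-canonical ((o , c) ∷ g) (k , ne) = ups-canonical g k , λ e e′ → ne (ups≡[] g e) (lemma e′)
  where
  ups≡[] : ∀ g → ups g ≡ [] → g ≡ []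
  ups≡[] [] _ = refl
  lemma : col o 0 false c ≡ ∅ᶜ → (o , c) ≡ ∅
  lemma refl = refl

canonical-ups : ∀ g → CanonicalC (ups g) → Canonical g
canonical-ups [] _ = tt
canonical-ups ((o , c) ∷ g) (k , ne) = canonical-ups g k , λ e e′ → ne (cong ups e) (cong up e′)

ups-injective : ∀ g h → ups g ≡ ups h → g ≡ h
ups-injective [] [] _ = refl
ups-injective ((o , c) ∷ g) ((o′ , c′) ∷ h) e with ∷-injective e
... | refl , e′ = cong (_ ∷_) (ups-injective g h e′)

-- Transfer of membership

markedUpTo-sumV : ∀ {m} (N : Vec ℕ m) s L →
  (∀ (j : Fin m) → countℕ (suc (toℕ j + s)) L ≡ lookup N j) →
  markedUpTo (m + s) L ≡ sumV N + markedUpTo s L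
markedUpTo-sumV []ᵥ s L h = refl
markedUpTo-sumV {suc m} (x ∷ᵥ N) s L h = begin
  markedUpTo (suc m + s) L                ≡⟨ cong (λ z → markedUpTo z L) (sym (+-suc m s)) ⟩
  markedUpTo (m + suc s) L                ≡⟨ markedUpTo-sumV N (suc s) L h′ ⟩
  sumV N + (countℕ (suc s) L + markedUpTo s L) ≡⟨ cong (λ z → sumV N + (z + markedUpTo s L)) (h Fin.zero) ⟩
  sumV N + (x + markedUpTo s L)           ≡⟨ +-swap (sumV N) x _ ⟩
  x + (sumV N + markedUpTo s L)           ≡⟨ sym (+-assoc x (sumV N) _) ⟩
  x + sumV N + markedUpTo s L             ∎
  where
  open ≡-Reasoning
  h′ : ∀ j → countℕ (suc (toℕ j + suc s)) L ≡ lookup N j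
  h′ j = trans (cong (λ z → countℕ (suc z) L) (+-suc (toℕ j) s)) (h (Fin.suc j))

-- The data that decide membership in `InF`, apart from the condition on the smallest part.
record _≈_ (cs ds : List Col) : Set where
  field
    greedy≡ : ∀ q → greedyC (suc q) (suc q) cs ≡ greedyC (suc q) (suc q) ds
    number≡ : numberC cs ≡ numberC ds
    f̄₁≡     : f̄ 1 (parts 0 cs) ≡ f̄ 1 (parts 0 ds)
    f₂≡     : f 2 (parts 0 cs) ≡ f 2 (parts 0 ds)

≈-sym : ∀ {cs ds} → cs ≈ ds → ds ≈ cs
≈-sym e = record { greedy≡ = λ q → sym (greedy≡ q) ; number≡ = sym number≡ ; f̄₁≡ = sym f̄₁≡ ; f₂≡ = sym f₂≡ }
  where open _≈_ e

phi-≈ : ∀ cs → cs ≈ ups (proj₂ (phi cs))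
phi-≈ cs = record
  { greedy≡ = λ q → trans (phi-greedy q cs ≤-refl) (sym (greedyC-ups (suc q) ≤-refl (proj₂ (phi cs))))
  ; number≡ = trans (sym (phi-number cs)) (sym (numberC-ups (proj₂ (phi cs))))
  ; f̄₁≡ = f̄₁≡ cs ; f₂≡ = f₂≡ cs }
  where
  f̄₁≡ : ∀ cs → f̄ 1 (parts 0 cs) ≡ f̄ 1 (parts 0 (ups (proj₂ (phi cs))))
  f̄₁≡ [] = refl
  f̄₁≡ (col o n b c ∷ cs) = trans (f̄₁ o n b c cs) (sym (f̄₁ o 0 false c (ups (proj₂ (drain n b (phi cs))))))
  f₂≡ : ∀ cs → f 2 (parts 0 cs) ≡ f 2 (parts 0 (ups (proj₂ (phi cs))))
  f₂≡ [] = refl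
  f₂≡ (col o n b c ∷ cs) = trans (f₂ o n b c cs) (sym (f₂ o 0 false c (ups (proj₂ (drain n b (phi cs))))))

smallest⇒nonempty : ∀ {lam} → SmallestOK lam → length lam ≢ 0
smallest⇒nonempty {_ ∷ _} _ ()

markedUpTo-≈ : ∀ {cs ds} → cs ≈ ds → ∀ t →
  markedUpTo t (marks (parts 0 cs)) ≡ markedUpTo t (marks (parts 0 ds))
markedUpTo-≈ e zero    = refl
markedUpTo-≈ {cs} {ds} e (suc q) =
  trans (marks-greedy q cs) (trans (_≈_.greedy≡ e q) (sym (marks-greedy q ds)))

-- The `r`-marked parts are counted by a difference of two cumulative counts.
markedCount-≈ : ∀ {cs ds} → cs ≈ ds → ∀ t →
  markedCount (suc t) (parts 0 cs) ≡ markedCount (suc t) (parts 0 ds)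
markedCount-≈ {cs} {ds} e t = +-cancelʳ-≡ (markedUpTo t (marks (parts 0 cs))) _ _
  (trans (markedUpTo-≈ e (suc t)) (cong (markedCount (suc t) (parts 0 ds) +_) (sym (markedUpTo-≈ e t))))

-- The parts of `cs` number `sumV N`, which also counts those with mark at most `k - 1`. So capacity
-- `k - 1` selects everything in `cs`, hence in `ds`, and `saturated` applies to `ds`.
InF-≈ : ∀ k i N {cs ds} → cs ≈ ds → StartOK ds → InF k i N (parts 0 cs) → InF k i N (parts 0 ds)
-- For `k ≤ 1` there would be no parts at all, yet a smallest part exists.
InF-≈ 0 i []ᵥ e s ((_ , (_ , len , _) , small) , _) = ⊥-elim (smallest⇒nonempty small len)
InF-≈ 1 i []ᵥ e s ((_ , (_ , len , _) , small) , _) = ⊥-elim (smallest⇒nonempty small len)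
InF-≈ (suc (suc q)) i N {cs} {ds} e s ((_ , (_ , len , _ , c₁ , _) , _) , marked) =
  (_ , (parts-overpartition ds , len′ , refl , c₁′ , c₂ , c₃) , start⇒smallest 0 ds refl s) ,
  λ j → trans (sym (markedCount-≈ e (toℕ j))) (marked j)
  where
  open _≈_ e
  r = suc q
  len′ : length (parts 0 ds) ≡ sumV N
  len′ = trans (length-parts 0 ds) (trans (sym number≡) (trans (sym (length-parts 0 cs)) len))
  c₁′ : f̄ 1 (parts 0 ds) + f 2 (parts 0 ds) + 1 ≤ i
  c₁′ = subst₂ (λ x y → x + y + 1 ≤ i) f̄₁≡ f₂≡ c₁
  full : greedyC r r ds ≡ numberC ds
  full = begin
    greedyC r r ds                        ≡⟨ sym (greedy≡ q) ⟩
    greedyC r r cs                        ≡⟨ sym (marks-greedy q cs) ⟩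
    markedUpTo r (marks (parts 0 cs))     ≡⟨ cong (λ z → markedUpTo z (marks (parts 0 cs))) (sym (+-identityʳ r)) ⟩
    markedUpTo (r + 0) (marks (parts 0 cs)) ≡⟨ markedUpTo-sumV N 0 _ (λ j →
        trans (cong (λ z → markedCount (suc z) (parts 0 cs)) (+-identityʳ (toℕ j))) (marked j)) ⟩
    sumV N + 0                            ≡⟨ +-identityʳ _ ⟩
    sumV N                                ≡⟨ sym len′ ⟩
    length (parts 0 ds)                   ≡⟨ length-parts 0 ds ⟩
    numberC ds                            ∎
    where open ≡-Reasoning
  S : Sat r 0 ds
  S = saturated q ds z≤n full
  c₂ : ∀ t → f̄ (2 * t) (parts 0 ds) + f (2 * t) (parts 0 ds) + f̄ (2 * t + 1) (parts 0 ds)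
             + f (2 * t + 2) (parts 0 ds) + 1 ≤ suc r
  c₂ t rewrite +-comm (2 * t) 1 | +-comm (2 * t) 2 | 2*≡double t =
    ≤-trans (≤-reflexive (+-comm _ 1)) (s≤s (sat-coverage t ds S))
  c₃ : ∀ t → 1 ≤ f (2 * t + 1) (parts 0 ds) → f (2 * t + 2) (parts 0 ds) + 2 ≤ suc r
  c₃ t h rewrite +-comm (2 * t) 1 | +-comm (2 * t) 2 | 2*≡double t =
    ≤-trans (≤-reflexive (+-suc _ 1)) (s≤s (sat-odd t ds S h))

firstV-greedy : ∀ k i N cs → InF k i N (parts 0 cs) → firstV N ≡ greedyC 1 1 cs
firstV-greedy 0 i []ᵥ cs ((_ , (_ , len , _) , small) , _) = ⊥-elim (smallest⇒nonempty small len)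
firstV-greedy 1 i []ᵥ cs ((_ , (_ , len , _) , small) , _) = ⊥-elim (smallest⇒nonempty small len)
firstV-greedy (suc (suc q)) i (x ∷ᵥ N) cs (_ , marked) =
  trans (sym (marked Fin.zero)) (trans (sym (+-identityʳ _)) (marks-greedy 0 cs))

-- Negative even integers and the final assembly

open import Data.Integer as ℤ using (ℤ; +_; -_) renaming (_+_ to _+ℤ_)
import Data.Integer.Properties as ℤ

minusTwice : ℕ → ℤ
minusTwice j = - (+ (2 * j))

minusTwice-injective : ∀ {i j} → minusTwice i ≡ minusTwice j → i ≡ j
minusTwice-injective {i} {j} e = *-cancelˡ-≡ i j 2 (ℤ.+-injective (ℤ.neg-injective e))

minusTwice-anti-< : ∀ {i j} → j < i → minusTwice i ℤ.< minusTwice j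
minusTwice-anti-< l = ℤ.neg-mono-< (ℤ.+<+ (*-monoʳ-< 2 l))

minusTwice-cancel-< : ∀ {i j} → minusTwice i ℤ.< minusTwice j → j < i
minusTwice-cancel-< {i} {j} l = *-cancelˡ-< 2 j i (ℤ.drop‿+<+ (ℤ.neg-cancel-< l))

sum-minusTwice : ∀ js → sumℤ (map minusTwice js) ≡ - (+ (2 * sum js))
sum-minusTwice [] = refl
sum-minusTwice (j ∷ js) = begin
  minusTwice j +ℤ sumℤ (map minusTwice js) ≡⟨ cong (λ z → minusTwice j +ℤ z) (sum-minusTwice js) ⟩
  - (+ (2 * j)) +ℤ - (+ (2 * sum js))      ≡⟨ sym (ℤ.neg-distrib-+ (+ (2 * j)) (+ (2 * sum js))) ⟩
  - (+ (2 * j + 2 * sum js))                ≡⟨ cong (λ z → - (+ z)) (sym (*-distribˡ-+ 2 j (sum js))) ⟩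
  - (+ (2 * (j + sum js)))                  ∎
  where open ≡-Reasoning

read-R : ∀ {n} τ → InR n τ →
  ∃ λ js → map minusTwice js ≡ τ × Linked _>_ js × All (1 ≤_) js × All (_≤ n) js
read-R {n} τ (lk , al) with shape al
  where
  shape : ∀ {τ} → All (λ x → Σ ℕ (λ j → 1 ≤ j × j ≤ n × x ≡ - (+ (2 * j)))) τ →
    ∃ λ js → map minusTwice js ≡ τ × All (1 ≤_) js × All (_≤ n) js
  shape [] = [] , refl , [] , []
  shape ((j , p , b , refl) ∷ h) with shape h
  ... | js , refl , ps , bs = j ∷ js , refl , p ∷ ps , b ∷ bs
... | js , refl , ps , bs =
  js , refl , Linked.map (minusTwice-cancel-<) (Linked.map⁻ lk) , ps , bs

Φ : List Part → List ℤ × List Part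
Φ lam = map minusTwice (proj₁ (phi (columns lam))) , parts 0 (ups (proj₂ (phi (columns lam))))

module _ (k i : ℕ) (N : Vec ℕ (k ∸ 1)) where

  parts-columns-F : ∀ {lam} → InF k i N lam → parts 0 (columns lam) ≡ lam
  parts-columns-F {lam} ((_ , (over , _) , _) , _) =
    parts-columns lam (proj₁ over) (overpartition-ordered lam over)

  canonical-F : ∀ {lam} → InF k i N lam → CanonicalC (columns lam)
  canonical-F {lam} ((_ , (over , _) , _) , _) = columns-canonical lam (proj₁ over)

  Φ-lands : ∀ cs → InF k i N (parts 0 cs) →
    InR (firstV N ∸ 1) (map minusTwice (proj₁ (phi cs)))
    × InG k i N (parts 0 (ups (proj₂ (phi cs))))
    × (+ total (parts 0 cs) ≡ sumℤ (map minusTwice (proj₁ (phi cs))) +ℤ (+ total (parts 0 (ups (proj₂ (phi cs))))))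
  Φ-lands cs F@((_ , _ , small) , _) =
    (Linked.map⁺ (Linked.map minusTwice-anti-< (Ranks.descending R)) ,
     All.map⁺ (All.zipWith (λ (p , b) → _ , p , b , refl) (Ranks.positive R , bounded))) ,
    (InF-≈ k i N (phi-≈ cs) (phi-start cs start) F , good-parts 0 g refl) ,
    weight≡
    where
    js = proj₁ (phi cs)
    g  = proj₂ (phi cs)
    R = phi-ranks cs
    start : StartOK cs
    start = smallest⇒start 0 cs refl small
    N₁≡ : firstV N ≡ greedy 1 1 g
    N₁≡ = trans (firstV-greedy k i N cs F) (phi-greedy 0 cs ≤-refl)
    bounded : All (_≤ firstV N ∸ 1) js
    bounded = All.map (λ {j} l → ∸-monoˡ-≤ 1 (≤-trans l (≤-reflexive (sym N₁≡)))) (ranks-start cs start)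
    w = weightC 0 cs
    s = 2 * sum js
    weight≡ : + total (parts 0 cs) ≡ sumℤ (map minusTwice js) +ℤ (+ total (parts 0 (ups g)))
    weight≡ = begin
      + total (parts 0 cs)      ≡⟨ cong +_ (total-parts 0 cs) ⟩
      + w                       ≡⟨ sym (ℤ.+-identityˡ (+ w)) ⟩
      + 0 +ℤ + w               ≡⟨ cong (λ z → z +ℤ + w) (sym (ℤ.+-inverseˡ (+ s))) ⟩
      - (+ s) +ℤ + s +ℤ + w   ≡⟨ ℤ.+-assoc (- (+ s)) (+ s) (+ w) ⟩
      - (+ s) +ℤ (+ (s + w))   ≡⟨ cong₂ (λ x y → x +ℤ (+ y)) (sym (sum-minusTwice js))
           (trans (+-comm s w) (trans (sym (phi-weight 0 cs)) (trans (sym (weightC-ups 0 g)) (sym (total-parts 0 (ups g)))))) ⟩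
      sumℤ (map minusTwice js) +ℤ (+ total (parts 0 (ups g))) ∎
      where open ≡-Reasoning

  Φ-injective : ∀ lam lam′ → InF k i N lam → InF k i N lam′ → Φ lam ≡ Φ lam′ → lam ≡ lam′
  Φ-injective lam lam′ F F′ e =
    trans (sym (parts-columns-F F)) (trans (cong (parts 0) cs≡) (parts-columns-F F′))
    where
    cs = columns lam
    ds = columns lam′
    g≡ : proj₂ (phi cs) ≡ proj₂ (phi ds)
    g≡ = ups-injective _ _ (trans (sym (columns-parts _ (ups-canonical _ (phi-canonical {cs} (canonical-F F)))))
      (trans (cong columns (cong proj₂ e)) (columns-parts _ (ups-canonical _ (phi-canonical {ds} (canonical-F F′))))))
    cs≡ : cs ≡ ds
    cs≡ = phi-injective cs ds (canonical-F F) (canonical-F F′)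
      (cong₂ _,_ (map-injective minusTwice-injective (cong proj₁ e)) g≡)

  Φ-surjective : ∀ τ μ → InR (firstV N ∸ 1) τ → InG k i N μ → ∃ λ lam → InF k i N lam × Φ lam ≡ (τ , μ)
  Φ-surjective τ μ R (F , hb , hn) with read-R τ R
  ... | js , refl , desc , ps , bs
    with parts-good 0 (columns μ) refl
           (subst (All NotBarEven) (sym (parts-columns-F F)) hb)
           (subst (All NotPlainOdd) (sym (parts-columns-F F)) hn)
  ... | g , ups≡ with phi-surjective-start js g
           (canonical-ups g (subst CanonicalC (sym ups≡) (canonical-F F)))
           (smallest⇒start 0 (ups g) refl (proj₂ (proj₂ (proj₁ F′)))) desc ps
           (All.zipWith (λ (p , b) → below p b) (ps , bs))
    where
    μ≡ : parts 0 (ups g) ≡ μ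
    μ≡ = trans (cong (parts 0) ups≡) (parts-columns-F F)
    F′ : InF k i N (parts 0 (ups g))
    F′ = subst (InF k i N) (sym μ≡) F
    N₁≡ : firstV N ≡ greedy 1 1 g
    N₁≡ = trans (firstV-greedy k i N (ups g) F′) (greedyC-ups 1 ≤-refl g)
    below : ∀ {j} → 1 ≤ j → j ≤ firstV N ∸ 1 → j < greedy 1 1 g
    below {j} p b = subst (j <_) N₁≡ (lemma (firstV N) b)
      where
      lemma : ∀ n → j ≤ n ∸ 1 → j < n
      -- `1 ≤ j` excludes `N₁ = 0`, where truncated subtraction would not give a strict bound.
      lemma zero    b = ⊥-elim (1+n≰n (≤-trans p b))
      lemma (suc n) b = s≤s b
  ... | cs , phi≡ , canon , start = parts 0 cs ,
    -- `cs` shares the deciding data with its image, so membership is carried back from `μ`.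
    InF-≈ k i N (≈-sym (subst (λ p → cs ≈ ups (proj₂ p)) phi≡ (phi-≈ cs))) start (subst (InF k i N) (sym μ≡) F) ,
    trans (cong (λ z → map minusTwice (proj₁ (phi z)) , parts 0 (ups (proj₂ (phi z)))) (columns-parts cs canon))
      (cong₂ _,_ (cong (λ p → map minusTwice (proj₁ p)) phi≡) (trans (cong (λ p → parts 0 (ups (proj₂ p))) phi≡) μ≡))
    where
    μ≡ : parts 0 (ups g) ≡ μ
    μ≡ = trans (cong (parts 0) ups≡) (parts-columns-F F)

theorem4p1 : (k i : ℕ) → 1 ≤ i → i ≤ k → (N : Vec ℕ (k ∸ 1))
  → (∀ (r s : Fin (k ∸ 1)) → r ≤ᶠ s → lookup N s ≤ lookup N r)
  → Σ (List Part → List ℤ × List Part) (λ Φ →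
      (∀ lam → InF k i N lam →
         InR (firstV N ∸ 1) (proj₁ (Φ lam))
         × InG k i N (proj₂ (Φ lam))
         × (+ total lam ≡ sumℤ (proj₁ (Φ lam)) +ℤ (+ total (proj₂ (Φ lam)))))
      × (∀ lam lam' → InF k i N lam → InF k i N lam' → Φ lam ≡ Φ lam' → lam ≡ lam')
      × (∀ τ μ → InR (firstV N ∸ 1) τ → InG k i N μ →
           ∃ (λ lam → InF k i N lam × Φ lam ≡ (τ , μ))))
theorem4p1 k i _ _ N _ = Φ , lands , Φ-injective k i N , Φ-surjective k i N
  where
  lands : ∀ lam → InF k i N lam →
    InR (firstV N ∸ 1) (proj₁ (Φ lam)) × InG k i N (proj₂ (Φ lam))
    × (+ total lam ≡ sumℤ (proj₁ (Φ lam)) +ℤ (+ total (proj₂ (Φ lam))))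
  lands lam F with parts-columns-F k i N F
  ... | e with Φ-lands k i N (columns lam) (subst (InF k i N) (sym e) F)
  ...   | inR , inG , weight≡ = inR , inG , trans (cong (λ l → + total l) (sym e)) weight≡
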